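{- Let $\alpha$ be a weakly Chaitin random real and let $V$ be an optimal computer. For every total recursive function $f\colon\mathbb{N}^+\to\mathbb{N}$, if there exists an oracle deterministic Turing machine $M$ such that, for infinitely many $n\in\mathbb{N}^+$, $M^{\mathrm{Dom}\,V\restriction n}(n)=\alpha\restriction(n-f(n))$, then $f$ is not bounded from above.
   Context: $\{0,1\}^*$ is the set of finite binary strings. A computer is a partial recursive function $C\colon\{0,1\}^*\to\{0,1\}^*$ whose domain $\mathrm{Dom}\,C$ is prefix-free. A computer $U$ is optimal if for every computer $C$ there is $d\in\mathbb{N}$ such that for every $p\in\mathrm{Dom}\,C$ there is $q$ with $U(q)=C(p)$ and $|q|\le|p|+d$. Fix an optimal computer $U$ and let $H(s)=\min\{|p|:U(p)=s\}$. A real $\alpha$ is weakly Chaitin random if there is $c\in\mathbb{N}$ with $n-c\le H(\alpha\restriction n)$ for all $n\in\mathbb{N}^+$. For $S\subseteq\{0,1\}^*$ and $n\in\mathbb{Z}$, $S\restriction n=\{s\in S:|s|\le n\}$. For a real $\alpha$ and $n\in\mathbb{N}^+$, $\alpha\restriction n$ is the string of the first $n$ bits of the base-two expansion of $\alpha-\lfloor\alpha\rfloor$ (with infinitely many zeros when there is a choice); for integers $n\le0$ it is the empty string. $M^A(n)$ is the output of oracle machine $M$ on input $n$ with oracle set $A$. -}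

module Defs where

open import Data.Nat using (ℕ; zero; suc; _+_; _*_; _∸_; _≤_; _≟_)
open import Data.Bool using (Bool; true; false)
open import Data.List using (List; []; _∷_; _++_; length; map; upTo)
open import Data.Maybe using (Maybe; just; nothing)
open import Data.Product using (Σ; ∃; _×_; _,_)
open import Data.Empty using (⊥)
open import Relation.Nullary using (¬_; yes; no)
open import Relation.Binary.PropositionalEquality using (_≡_)
open import Relation.Binary.Construct.Closure.ReflexiveTransitive using (Star)

Str : Set
Str = List Bool

encode : Str → ℕ
encode []          = 0
encode (false ∷ s) = suc (2 * encode s)
encode (true  ∷ s) = suc (suc (2 * encode s))

_≼_ : Str → Str → Set
p ≼ q = ∃ λ r → p ++ r ≡ q

-- Model of computation: oracle register (Minsky) machines.
-- Registers are indexed by ℕ and hold naturals; the program halts when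
-- the program counter leaves the program.

data Instr : Set where
  inc : (r j : ℕ) → Instr        -- R[r] := R[r]+1 ; goto j
  dec : (r j k : ℕ) → Instr      -- if R[r] = 0 goto k else R[r] := R[r]-1 ; goto j
  ask : (r j k : ℕ) → Instr      -- if R[r] codes a string in the oracle goto j else goto k

Program : Set
Program = List Instr

fetch : Program → ℕ → Maybe Instr
fetch []       _       = nothing
fetch (i ∷ _)  zero    = just i
fetch (_ ∷ is) (suc n) = fetch is n

Regs : Set
Regs = ℕ → ℕ

update : Regs → ℕ → ℕ → Regs
update R r v x with x ≟ r
... | yes _ = v
... | no  _ = R x

Config : Set
Config = ℕ × Regs

Oracle : Set₁
Oracle = Str → Set

InOracle : Oracle → ℕ → Set
InOracle A v = ∃ λ s → encode s ≡ v × A s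

data Step (A : Oracle) (P : Program) : Config → Config → Set where
  s-inc  : ∀ {pc R r j} → fetch P pc ≡ just (inc r j) →
           Step A P (pc , R) (j , update R r (suc (R r)))
  s-decZ : ∀ {pc R r j k} → fetch P pc ≡ just (dec r j k) → R r ≡ 0 →
           Step A P (pc , R) (k , R)
  s-decS : ∀ {pc R r j k m} → fetch P pc ≡ just (dec r j k) → R r ≡ suc m →
           Step A P (pc , R) (j , update R r m)
  s-askY : ∀ {pc R r j k} → fetch P pc ≡ just (ask r j k) → InOracle A (R r) →
           Step A P (pc , R) (j , R)
  s-askN : ∀ {pc R r j k} → fetch P pc ≡ just (ask r j k) → ¬ InOracle A (R r) →
           Step A P (pc , R) (k , R)

initRegs : ℕ → Regs
initRegs x zero    = x
initRegs x (suc _) = 0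

Runs : Oracle → Program → ℕ → ℕ → Set
Runs A P x y = ∃ λ pc → ∃ λ R →
  Star (Step A P) (0 , initRegs x) (pc , R) × fetch P pc ≡ nothing × R 0 ≡ y

∅ : Oracle
∅ _ = ⊥

-- Computers (partial recursive functions {0,1}* → {0,1}* with
-- prefix-free domain), given by a program

_⟦_⟧≡_ : Program → Str → Str → Set
C ⟦ p ⟧≡ s = Runs ∅ C (encode p) (encode s)

Dom : Program → Str → Set
Dom C p = ∃ λ s → C ⟦ p ⟧≡ s

IsComputer : Program → Set
IsComputer C = ∀ p q → Dom C p → Dom C q → p ≼ q → p ≡ q

IsOptimal : Program → Set
IsOptimal U = IsComputer U ×
  (∀ C → IsComputer C → ∃ λ d → ∀ p s → C ⟦ p ⟧≡ s →
     ∃ λ q → U ⟦ q ⟧≡ s × length q ≤ length p + d)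

_↾_ : (Str → Set) → ℕ → (Str → Set)
(S ↾ n) s = S s × length s ≤ n

-- Reals: only the base-two expansion of the fractional part matters;
-- it is an infinite bit sequence with infinitely many zeros.

BitSeq : Set
BitSeq = ℕ → Bool

InfinitelyManyZeros : BitSeq → Set
InfinitelyManyZeros α = ∀ m → ∃ λ k → m ≤ k × α k ≡ false

-- α ↾ n : first n bits (empty for n = 0; truncated subtraction gives
-- the empty string for "n ≤ 0")
bits : BitSeq → ℕ → Str
bits α n = map α (upTo n)

-- n - c ≤ H(s)  (H w.r.t. U), i.e. every U-program for s has length ≥ n - c
-- (in ℕ, n ∸ c ≤ H(s) is equivalent since H(s) ≥ 0)
WeaklyChaitinRandom : Program → BitSeq → Set
WeaklyChaitinRandom U α = ∃ λ c → ∀ n → 1 ≤ n →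
  ∀ p → U ⟦ p ⟧≡ bits α n → n ∸ c ≤ length p

-- total recursive f : ℕ⁺ → ℕ (values at 0 irrelevant)
TotalRecursive⁺ : (ℕ → ℕ) → Set
TotalRecursive⁺ f = ∃ λ F → ∀ n → 1 ≤ n → Runs ∅ F n (f n)

BoundedAbove⁺ : (ℕ → ℕ) → Set
BoundedAbove⁺ f = ∃ λ b → ∀ n → 1 ≤ n → f n ≤ b

{-# OPTIONS --safe #-}

-- Suppose f ≤ b. If V halts on p, |p| ≤ n, and t is the halting time of p, let
-- M run on n with oracle "the strings of length at most n on which V halts
-- within t steps". When p is the last string of length at most n to halt, this
-- oracle is Dom V ↾ n, so for infinitely many n some p yields a prefix of α of
-- length at least n − b. By Kraft's inequality the cylinders of all outputs of
-- length n − j with j ≤ b have total measure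
-- O(Σ_n Σ_{|p| ≤ n} 2^(−n)) = O(Σ_p 2^(−|p|)) < ∞; they form a Solovay test
-- which α fails. The strings lying in at least K·4^k of the cylinders therefore
-- generate an open set of measure at most 4^(−k). Enumerating that set by
-- stages, the s-th of which adds strings of length s, and coding the strings in
-- order of appearance by consecutive dyadic intervals gives prefix-free
-- codewords of length s − 2k; preceded by the header 0^k 1 they describe
-- prefixes of α of length s by s − k + 1 bits, for every k.

module Submission where

open import Defs
open import Data.Nat
open import Data.Nat.Properties
open import Data.Nat.Solver using (module +-*-Solver)
open import Data.Bool using (Bool; true; false; not)
open import Data.Bool.Properties using (not-involutive)
open import Data.Empty using (⊥; ⊥-elim)
open import Data.Fin using (Fin)
open import Data.Fin.Patterns using (0F; 1F; 2F; 3F; 4F; 5F)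
open import Data.List using ([]; _∷_; _++_; length; upTo)
open import Data.List.Properties
  using (++-identityʳ; length-++; length-map; length-upTo; map-applyUpTo; map-upTo; ∷-injective; ∷ʳ-injective)
open import Data.Maybe using (just; nothing)
open import Data.Maybe.Properties using (just-injective)
open import Data.Product using (Σ; ∃; _×_; _,_; proj₁; proj₂)
open import Data.Sum using (inj₁; inj₂)
open import Data.Unit using (⊤; tt)
open import Data.Vec using (Vec; []; _∷_; map; lookup; tail)
open import Data.Vec.Properties using (lookup-map; map-∘; map-cong)
open import Data.Vec.Relation.Unary.All using (All; []; _∷_)
open import Function using (_∘_; id)
open import Relation.Binary using (tri<; tri≈; tri>)
open import Relation.Binary.Construct.Closure.ReflexiveTransitive using (Star; ε; _◅_; _◅◅_)
open import Relation.Binary.PropositionalEquality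
open import Relation.Nullary using (¬_; yes; no)
open +-*-Solver using (solve; _:+_; _:*_; _:=_; con)

-- The last halting p is not itself a short description: its length may be close to n, so it need
-- not save any bits over a prefix of length n - b, and it cannot be recognised effectively. Hence
-- every halting p may guess, and wrong guesses are paid for in measure. Codewords gain 2k bits and
-- the header costs k + 1, which leaves a saving of k - 1. Since the header lets one decoder serve
-- all k, the simulation constant d is known before k is chosen, and k can be made to beat d
-- together with the randomness constant c. Measures stay in ℕ: at stage s they are counts of words
-- of length s, in units of 2^(-s). All ingredients are total functions assembled from sums, so
-- their computability follows by composition; divergence appears only at the end, when the value 0
-- of the decoder becomes an infinite loop. Which programs halt is undecidable, so a last one exists
-- only under double negation. This is enough because the goal is a negation.

infix 4 _≈_

-- Register contents up to pointwise equality

record _≈_ (R S : Regs) : Set where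
  constructor ptw
  field at : R ≗ S
open _≈_

update-eq : ∀ R r {v} → update R r v r ≡ v
update-eq R r with r ≟ r
... | yes _ = refl
... | no ne = ⊥-elim (ne refl)

update-neq : ∀ R {r v i} → i ≢ r → update R r v i ≡ R i
update-neq R {r} {i = i} ne with i ≟ r
... | yes e = ⊥-elim (ne e)
... | no _  = refl

≈-refl : ∀ {R} → R ≈ R
≈-refl = ptw λ _ → refl

≈-sym : ∀ {R S} → R ≈ S → S ≈ R
≈-sym e = ptw λ i → sym (at e i)

≈-trans : ∀ {R S T} → R ≈ S → S ≈ T → R ≈ T
≈-trans e f = ptw λ i → trans (at e i) (at f i)

update-cong : ∀ {R S r v w} → R ≈ S → v ≡ w → update R r v ≈ update S r w
at (update-cong {r = r} e refl) i with i ≟ r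
... | yes _ = refl
... | no _  = at e i

update-overwrite : ∀ {R r v w} → update (update R r v) r w ≈ update R r w
at (update-overwrite {R} {r}) i with i ≟ r
... | yes _ = refl
... | no ne = update-neq R ne

update-swap : ∀ {R r s v w} → r ≢ s →
  update (update R r v) s w ≈ update (update R s w) r v
at (update-swap {R} {r} {s} {v} {w} ne) i with i ≟ r | i ≟ s
... | yes a | yes b = ⊥-elim (ne (trans (sym a) b))
... | yes refl | no _  = update-eq R r
... | no _  | yes refl = sym (update-eq R s)
... | no a  | no b  = trans (update-neq R a) (sym (update-neq R b))

update-id : ∀ {R r v} → R r ≡ v → update R r v ≈ R
at (update-id {r = r} e) i with i ≟ r
... | yes refl = sym e
... | no _     = refl

-- Structured commands compiled to register machines

data Cmd : Set where
  skip      : Cmd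
  incr decr : ℕ → Cmd
  _⨾_       : Cmd → Cmd → Cmd
  while     : ℕ → Cmd → Cmd     -- while R[r] ≠ 0 { R[r] := R[r]−1 ; c }

infixr 5 _⨾_

size : Cmd → ℕ
size skip        = 0
size (incr r)    = 1
size (decr r)    = 1
size (c ⨾ c′)    = size c + size c′
size (while r c) = suc (size c + 1)

-- With the empty oracle, ask serves as an unconditional jump.
code : Cmd → ℕ → Program
code skip        o = []
code (incr r)    o = inc r (suc o) ∷ []
code (decr r)    o = dec r (suc o) (suc o) ∷ []
code (c ⨾ c′)    o = code c o ++ code c′ (o + size c)
code (while r c) o =
  dec r (suc o) (o + size (while r c)) ∷ code c (suc o) ++ ask 0 o o ∷ []

length-code : ∀ c o → length (code c o) ≡ size c
length-code skip        o = refl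
length-code (incr r)    o = refl
length-code (decr r)    o = refl
length-code (c ⨾ c′)    o =
  trans (length-++ (code c o)) (cong₂ _+_ (length-code c o) (length-code c′ _))
length-code (while r c) o =
  cong suc (trans (length-++ (code c _)) (cong (_+ 1) (length-code c _)))

At : Program → ℕ → Program → Set
At P o []       = ⊤
At P o (i ∷ is) = fetch P o ≡ just i × At P (suc o) is

At-++⁻ : ∀ {P} o xs {ys} → At P o (xs ++ ys) → At P o xs × At P (o + length xs) ys
At-++⁻ {P} o []       {ys} a = tt , subst (λ z → At P z ys) (sym (+-identityʳ o)) a
At-++⁻ {P} o (x ∷ xs) {ys} (e , a) with At-++⁻ (suc o) xs a
... | a₁ , a₂ = (e , a₁) , subst (λ z → At P z ys) (sym (+-suc o (length xs))) a₂

At-suc : ∀ {P i o} xs → At P o xs → At (i ∷ P) (suc o) xs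
At-suc []       a       = tt
At-suc (x ∷ xs) (e , a) = e , At-suc xs a

At-self : ∀ P → At P 0 P
At-self []      = tt
At-self (i ∷ P) = refl , At-suc P (At-self P)

fetch-end : ∀ P {n} → length P ≡ n → fetch P n ≡ nothing
fetch-end []      refl = refl
fetch-end (i ∷ P) refl = fetch-end P refl

-- A total-correctness triple. Quantifying over the host program `P` and the offset `o` makes
-- compiled fragments relocatable; working up to `≈` allows updates to be rearranged without
-- function extensionality.
record ⟪_⟫_⟪_⟫ (R : Regs) (c : Cmd) (R′ : Regs) : Set where
  field exec : ∀ P o S → At P o (code c o) → S ≈ R →
          ∃ λ S′ → Star (Step ∅ P) (o , S) (o + size c , S′) × S′ ≈ R′
open ⟪_⟫_⟪_⟫

conseq : ∀ {R S S′ R′ c} → R ≈ S → ⟪ S ⟫ c ⟪ S′ ⟫ → S′ ≈ R′ → ⟪ R ⟫ c ⟪ R′ ⟫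
exec (conseq e t e′) P o Q a q with exec t P o Q a (≈-trans q e)
... | Q′ , st , q′ = Q′ , st , ≈-trans q′ e′

skip-rule : ∀ {R} → ⟪ R ⟫ skip ⟪ R ⟫
exec skip-rule P o S a e =
  S , subst (λ z → Star (Step ∅ P) (o , S) (z , S)) (sym (+-identityʳ o)) ε , e

incr-rule : ∀ {R r} → ⟪ R ⟫ incr r ⟪ update R r (suc (R r)) ⟫
exec (incr-rule {R} {r}) P o S (f , _) e = S′ ,
  subst (λ z → Star (Step ∅ P) (o , S) (z , S′)) (+-comm 1 o) (s-inc f ◅ ε) ,
  update-cong e (cong suc (at e r))
  where S′ = update S r (suc (S r))

decr-rule : ∀ {R r} → ⟪ R ⟫ decr r ⟪ update R r (pred (R r)) ⟫
exec (decr-rule {R} {r}) P o S (f , _) e = go (S r) refl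
  where
  go : ∀ m → S r ≡ m → ∃ λ S′ →
    Star (Step ∅ P) (o , S) (o + 1 , S′) × S′ ≈ update R r (pred (R r))
  go zero    q = S ,
    subst (λ z → Star (Step ∅ P) (o , S) (z , S)) (+-comm 1 o) (s-decZ f q ◅ ε) ,
    ≈-trans e (≈-sym (update-id (trans Rr≡0 (cong pred (sym Rr≡0)))))
    where Rr≡0 = trans (sym (at e r)) q
  go (suc m) q = S′ ,
    subst (λ z → Star (Step ∅ P) (o , S) (z , S′)) (+-comm 1 o) (s-decS f q ◅ ε) ,
    update-cong e (cong pred (trans (sym q) (at e r)))
    where S′ = update S r m

seq-rule : ∀ {R R′ R″ c c′} → ⟪ R ⟫ c ⟪ R′ ⟫ → ⟪ R′ ⟫ c′ ⟪ R″ ⟫ → ⟪ R ⟫ c ⨾ c′ ⟪ R″ ⟫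
exec (seq-rule {c = c} {c′} t t′) P o S a e
  with At-++⁻ o (code c o) a
... | a₁ , a₂ with exec t P o S a₁ e
... | S′ , st , e′
  with exec t′ P (o + size c) S′ (subst (λ z → At P (o + z) (code c′ (o + size c))) (length-code c o) a₂) e′
... | S″ , st′ , e″ = S″ ,
  subst (λ z → Star (Step ∅ P) (o , S) (z , S″)) (+-assoc o (size c) (size c′)) (st ◅◅ st′) , e″

while-zero : ∀ {R r c} → R r ≡ 0 → ⟪ R ⟫ while r c ⟪ R ⟫
exec (while-zero {r = r} q) P o S (f , _) e = S , s-decZ f (trans (at e r) q) ◅ ε , e

¬InOracle∅ : ∀ {v} → ¬ InOracle ∅ v
¬InOracle∅ (_ , _ , ())

while-suc : ∀ {R R′ R″ r c m} → R r ≡ suc m →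
  ⟪ update R r m ⟫ c ⟪ R′ ⟫ → ⟪ R′ ⟫ while r c ⟪ R″ ⟫ → ⟪ R ⟫ while r c ⟪ R″ ⟫
exec (while-suc {r = r} {c} q t t′) P o S (f , a) e
  with At-++⁻ (suc o) (code c (suc o)) a
... | a₁ , (j , _) with exec t P (suc o) _ a₁ (update-cong e refl)
... | S′ , st , e′ with exec t′ P o S′ (f , a) e′
... | S″ , st′ , e″ = S″ ,
  s-decS f (trans (at e r) q) ◅ (st ◅◅
    s-askN (trans (cong (λ z → fetch P (suc o + z)) (sym (length-code c (suc o)))) j) ¬InOracle∅ ◅ st′) , e″

-- Moving and copying registers

clear : ℕ → Cmd
clear r = while r skip

clear-rule : ∀ {R} r → ⟪ R ⟫ clear r ⟪ update R r 0 ⟫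
clear-rule {R} r = go (R r) refl
  where
  go : ∀ n {R} → R r ≡ n → ⟪ R ⟫ clear r ⟪ update R r 0 ⟫
  go zero    q = conseq ≈-refl (while-zero q) (≈-sym (update-id q))
  go (suc n) {R} q = while-suc q skip-rule
    (conseq ≈-refl (go n (update-eq R r)) update-overwrite)

n≢1+n : ∀ n → n ≢ suc n
n≢1+n n = 1+n≢n ∘ sym

-- Moves the content of register 1 + d to register d.
pop : ℕ → Cmd
pop d = clear d ⨾ while (suc d) (incr d)

pop-rule : ∀ {R d x y} → R (suc d) ≡ 0 →
  ⟪ update (update R d x) (suc d) y ⟫ pop d ⟪ update R d y ⟫
pop-rule {R} {d} {x} {y} z =
  seq-rule (clear-rule d)
    (conseq (≈-trans (update-swap 1+n≢n) (update-cong update-overwrite refl)) (go y 0)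
      (update-cong ≈-refl (+-identityʳ y)))
  where
  go : ∀ y x → ⟪ update (update R d x) (suc d) y ⟫ while (suc d) (incr d) ⟪ update R d (y + x) ⟫
  go zero x = conseq ≈-refl (while-zero (update-eq (update R d x) (suc d)))
    (update-id (trans (update-neq R 1+n≢n) z))
  go (suc y) x = while-suc (update-eq (update R d x) (suc d))
    (conseq update-overwrite incr-rule
      (≈-trans (update-cong ≈-refl (cong suc
                 (trans (update-neq (update R d x) (n≢1+n d)) (update-eq R d))))
        (≈-trans (update-swap 1+n≢n) (update-cong update-overwrite refl))))
    (conseq ≈-refl (go y (suc x)) (update-cong ≈-refl (+-suc y x)))

-- Register 1 + d is used as scratch space.
copy : ℕ → ℕ → Cmd
copy r d = while r (incr d ⨾ incr (suc d)) ⨾ while (suc d) (incr r)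

-- The source is drained into `d` and `suc d` together and then refilled from `suc d`; `St`
-- describes every intermediate state by these three contents.
copy-rule : ∀ {R r d} → r < d → R d ≡ 0 → R (suc d) ≡ 0 →
  ⟪ R ⟫ copy r d ⟪ update R d (R r) ⟫
copy-rule {R} {r} {d} r<d z z′ =
  conseq
    (≈-sym (≈-trans (update-id (trans (update-neq (update R r (R r)) 1+n≢n) (trans (update-neq R d′≢r) z′)))
      (≈-trans (update-id (trans (update-neq R d≢r) z)) (update-id refl))))
    (seq-rule (forth (R r) 0) (back (R r + 0) 0 (R r + 0)))
    (≈-trans (update-id (trans (update-neq (update R r _) 1+n≢n) (trans (update-neq R d′≢r) z′)))
      (≈-trans (update-swap (d≢r ∘ sym)) (≈-trans
        (update-id (trans (update-neq R (d≢r ∘ sym)) (sym (trans (+-identityʳ (R r + 0)) (+-identityʳ (R r))))))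
        (update-cong ≈-refl (+-identityʳ (R r))))))
  where
  d≢r : d ≢ r
  d≢r = >⇒≢ r<d
  d′≢r : suc d ≢ r
  d′≢r = >⇒≢ (m≤n⇒m≤1+n r<d)
  St : ℕ → ℕ → ℕ → Regs
  St x y y′ = update (update (update R r x) d y) (suc d) y′
  St-r : ∀ {x y y′} → St x y y′ r ≡ x
  St-r {x} {y} = trans (update-neq (update (update R r x) d y) (d′≢r ∘ sym))
    (trans (update-neq (update R r x) (d≢r ∘ sym)) (update-eq R r))
  St-d : ∀ {x y y′} → St x y y′ d ≡ y
  St-d {x} {y} = trans (update-neq (update (update R r x) d y) (n≢1+n d)) (update-eq (update R r x) d)
  St-d′ : ∀ {x y y′} → St x y y′ (suc d) ≡ y′
  St-d′ {x} {y} = update-eq (update (update R r x) d y) (suc d)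
  set-r : ∀ {x y y′ v w} → v ≡ w → update (St x y y′) r v ≈ St w y y′
  set-r refl = ≈-trans (update-swap d′≢r) (update-cong
    (≈-trans (update-swap d≢r) (update-cong update-overwrite refl)) refl)
  set-d : ∀ {x y y′ v w} → v ≡ w → update (St x y y′) d v ≈ St x w y′
  set-d refl = ≈-trans (update-swap 1+n≢n) (update-cong update-overwrite refl)
  set-d′ : ∀ {x y y′ v w} → v ≡ w → update (St x y y′) (suc d) v ≈ St x y w
  set-d′ refl = update-overwrite
  forth : ∀ x y → ⟪ St x y y ⟫ while r (incr d ⨾ incr (suc d)) ⟪ St 0 (x + y) (x + y) ⟫
  forth zero    y = while-zero St-r
  forth (suc x) y = while-suc St-r
    (seq-rule
      (conseq (set-r refl) incr-rule (set-d (cong suc St-d)))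
      (conseq ≈-refl incr-rule (set-d′ (cong suc St-d′))))
    (conseq ≈-refl (forth x (suc y))
      (update-cong (update-cong ≈-refl (+-suc x y)) (+-suc x y)))
  back : ∀ y′ x y → ⟪ St x y y′ ⟫ while (suc d) (incr r) ⟪ St (y′ + x) y 0 ⟫
  back zero     x y = while-zero St-d′
  back (suc y′) x y = while-suc St-d′
    (conseq (set-d′ refl) incr-rule (set-r (cong suc St-r)))
    (conseq ≈-refl (back y′ (suc x) y)
      (update-cong (update-cong (update-cong ≈-refl (+-suc y′ x)) refl) refl))

-- Registers below d are live, those from d on are zero; the value of f on the
-- live registers listed in vars is left in register d.
Evaluates : ∀ {m} → (Vec ℕ m → ℕ) → Vec ℕ m → ℕ → Cmd → Set
Evaluates f vars d c = ∀ R → (∀ i → d ≤ i → R i ≡ 0) →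
  ⟪ R ⟫ c ⟪ update R d (f (map R vars)) ⟫

-- Arguments sit in arbitrary registers below `d` and everything from `d` on is free, so registers
-- act as a stack and compiled pieces nest without renumbering.
record Computable {m} (f : Vec ℕ m → ℕ) : Set where
  constructor computable
  field compile : ∀ vars d → All (_< d) vars → Σ Cmd (Evaluates f vars d)
open Computable

map-update : ∀ {m} R d v {vars : Vec ℕ m} → All (_< d) vars →
  map (update R d v) vars ≡ map R vars
map-update R d v []       = refl
map-update R d v (p ∷ ps) = cong₂ _∷_ (update-neq R (<⇒≢ p)) (map-update R d v ps)

All-suc : ∀ {m d} {vars : Vec ℕ m} → All (_< d) vars → All (_< suc d) vars
All-suc []       = []
All-suc (p ∷ ps) = m≤n⇒m≤1+n p ∷ All-suc ps

All-lookup : ∀ {m d} {vars : Vec ℕ m} → All (_< d) vars → ∀ i → lookup vars i < d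
All-lookup (p ∷ ps) Fin.zero    = p
All-lookup (p ∷ ps) (Fin.suc i) = All-lookup ps i

zeros-update : ∀ {R d v} → (∀ i → d ≤ i → R i ≡ 0) → ∀ i → suc d ≤ i → update R d v i ≡ 0
zeros-update {R} z i p = trans (update-neq R (>⇒≢ p)) (z i (<⇒≤ p))

ext : ∀ {m} {f g : Vec ℕ m → ℕ} → (∀ ρ → f ρ ≡ g ρ) → Computable f → Computable g
compile (ext e F) vars d a with compile F vars d a
... | c , t = c , λ R z → conseq ≈-refl (t R z) (update-cong ≈-refl (e _))

zeroᶜ : ∀ {m} → Computable {m} (λ _ → 0)
compile zeroᶜ vars d a = skip , λ R z →
  conseq ≈-refl skip-rule (≈-sym (update-id (z d ≤-refl)))

varᶜ : ∀ {m} (i : Fin m) → Computable (λ ρ → lookup ρ i)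
compile (varᶜ i) vars d a = copy (lookup vars i) d , λ R z →
  conseq ≈-refl (copy-rule (All-lookup a i) (z d ≤-refl) (z (suc d) (n≤1+n d)))
    (update-cong ≈-refl (sym (lookup-map i R vars)))

sucᶜ : ∀ {m} {f : Vec ℕ m → ℕ} → Computable f → Computable (λ ρ → suc (f ρ))
compile (sucᶜ F) vars d a with compile F vars d a
... | c , t = c ⨾ incr d , λ R z → seq-rule (t R z)
  (conseq ≈-refl incr-rule (≈-trans (update-cong ≈-refl (cong suc (update-eq R d))) update-overwrite))

predᶜ : ∀ {m} {f : Vec ℕ m → ℕ} → Computable f → Computable (λ ρ → pred (f ρ))
compile (predᶜ F) vars d a with compile F vars d a
... | c , t = c ⨾ decr d , λ R z → seq-rule (t R z)
  (conseq ≈-refl decr-rule (≈-trans (update-cong ≈-refl (cong pred (update-eq R d))) update-overwrite))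

weakenᶜ : ∀ {m} {f : Vec ℕ m → ℕ} → Computable f → Computable (λ ρ → f (tail ρ))
compile (weakenᶜ {f = f} F) (v ∷ vars) d (_ ∷ a) = compile F vars d a

renameᶜ : ∀ {k m} {f : Vec ℕ k → ℕ} → Computable f → (σ : Vec (Fin m) k) →
  Computable (λ ρ → f (map (lookup ρ) σ))
compile (renameᶜ {f = f} F σ) vars d a with compile F (map (lookup vars) σ) d (go σ)
  where
  go : ∀ {k} (σ : Vec _ k) → All (_< d) (map (lookup vars) σ)
  go []      = []
  go (i ∷ σ) = All-lookup a i ∷ go σ
... | c , t = c , λ R z → conseq ≈-refl (t R z)
  (update-cong ≈-refl (cong f (trans (sym (map-∘ R (lookup vars) σ))
    (map-cong (λ i → sym (lookup-map i R vars)) σ))))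

letᶜ : ∀ {m} {f : Vec ℕ m → ℕ} {g : Vec ℕ (suc m) → ℕ} →
  Computable f → Computable g → Computable (λ ρ → g (f ρ ∷ ρ))
compile (letᶜ {f = f} {g} F G) vars d a
  with compile F vars d a | compile G (d ∷ vars) (suc d) (≤-refl ∷ All-suc a)
... | c , t | c′ , t′ = c ⨾ c′ ⨾ pop d , λ R z →
  seq-rule (t R z) (seq-rule
    (conseq ≈-refl (t′ (update R d (f (map R vars))) (zeros-update z))
      (update-cong ≈-refl (cong g (cong₂ _∷_ (update-eq R d) (map-update R d _ a)))))
    (pop-rule (z (suc d) (n≤1+n d))))

rec : ℕ → ℕ → (ℕ → ℕ → ℕ) → ℕ
rec zero    z s = z
rec (suc n) z s = s n (rec n z s)

-- Registers d, 1 + d and 2 + d hold the countdown, the index and the accumulator.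
recᶜ : ∀ {m} {n z : Vec ℕ m → ℕ} {s : Vec ℕ (2 + m) → ℕ} →
  Computable n → Computable z → Computable s →
  Computable (λ ρ → rec (n ρ) (z ρ) (λ i x → s (x ∷ i ∷ ρ)))
compile (recᶜ {n = n} {z} {s} N Z S) vars d a
  with compile N vars d a
     | compile Z vars (2 + d) (All-suc (All-suc a))
     | compile S (2 + d ∷ suc d ∷ vars) (3 + d)
         (≤-refl ∷ m≤n⇒m≤1+n ≤-refl ∷ All-suc (All-suc (All-suc a)))
... | cₙ , tₙ | c₀ , t₀ | cₛ , tₛ =
  command , proof
  where
  body = cₛ ⨾ pop (2 + d) ⨾ incr (suc d)
  command = cₙ ⨾ c₀ ⨾ while d body ⨾ pop (suc d) ⨾ pop d
  proof : Evaluates (λ ρ → rec (n ρ) (z ρ) (λ i x → s (x ∷ i ∷ ρ))) vars d command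
  proof R zs = seq-rule (tₙ R zs) (seq-rule
      (conseq (≈-sym (update-id (trans (update-neq R (1+n≢n)) (zs _ (n≤1+n d)))))
        (t₀ (update (update R d (n ρ)) (suc d) 0) (zeros-update (zeros-update zs)))
        (update-cong ≈-refl (cong z (trans (map-update _ (suc d) 0 (All-suc a)) (map-update R d (n ρ) a)))))
      (seq-rule (loop (n ρ) 0 (n ρ) (+-identityʳ (n ρ)))
        (seq-rule (pop-rule (trans (update-neq R 2+n≢n) (zs _ (m≤n+m d 2))))
          (pop-rule (zs _ (n≤1+n d))))))
    where
    ρ = map R vars
    2+n≢n : 2 + d ≢ d
    2+n≢n = >⇒≢ (m≤n+m (suc d) 1)
    3+n≢n : 3 + d ≢ d
    3+n≢n = >⇒≢ (m≤n+m (suc d) 2)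
    3+n≢1+n : 3 + d ≢ suc d
    3+n≢1+n = >⇒≢ (m≤n+m (2 + d) 1)
    St : ℕ → ℕ → ℕ → Regs
    St k i x = update (update (update R d k) (suc d) i) (2 + d) x
    val : ℕ → ℕ
    val i = rec i (z ρ) (λ i x → s (x ∷ i ∷ ρ))
    loop : ∀ k i n → k + i ≡ n →
      ⟪ St k i (val i) ⟫ while d body ⟪ St 0 n (val n) ⟫
    loop zero i .i refl = while-zero (trans (update-neq (update (update R d 0) (suc d) i) (2+n≢n ∘ sym))
      (trans (update-neq (update R d 0) (n≢1+n d)) (update-eq R d)))
    loop (suc k) i n e = while-suc
      (trans (update-neq (update (update R d (suc k)) (suc d) i) (2+n≢n ∘ sym))
        (trans (update-neq (update R d (suc k)) (n≢1+n d)) (update-eq R d)))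
      (conseq (≈-trans (update-swap 2+n≢n)
                (update-cong (≈-trans (update-swap 1+n≢n) (update-cong update-overwrite refl)) refl))
        (seq-rule
          (conseq ≈-refl (tₛ (St k i (val i)) (zeros-update (zeros-update (zeros-update zs))))
            (update-cong ≈-refl (cong s (cong₂ _∷_ (update-eq (update (update R d k) (suc d) i) (2 + d))
              (cong₂ _∷_ (trans (update-neq (update (update R d k) (suc d) i) (n≢1+n (suc d))) (update-eq (update R d k) (suc d)))
                (trans (map-update (update (update R d k) (suc d) i) (2 + d) (val i) (All-suc (All-suc a)))
                  (trans (map-update (update R d k) (suc d) i (All-suc a)) (map-update R d k a))))))))
          (seq-rule
            (pop-rule (trans (update-neq (update R d k) 3+n≢1+n) (trans (update-neq R 3+n≢n) (zs _ (m≤n+m d 3)))))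
            incr-rule))
        (≈-trans (update-cong ≈-refl (cong suc
            (trans (update-neq (update (update R d k) (suc d) i) (n≢1+n (suc d))) (update-eq (update R d k) (suc d)))))
          (≈-trans (update-swap 1+n≢n) (update-cong update-overwrite refl))))
      (loop k (suc i) n (trans (+-suc k i) e))

-- Realisation by a register machine: the value suc y encodes output y, and the
-- value 0 encodes divergence.

execute : Instr → Config → Config
execute (inc r j)   (pc , R) = j , update R r (suc (R r))
execute (dec r j k) (pc , R) = branch (R r)
  where
  branch : ℕ → Config
  branch zero    = k , R
  branch (suc m) = j , update R r m
execute (ask r j k) (pc , R) = k , R

Step⇒execute : ∀ {P c c′} → Step ∅ P c c′ →
  ∃ λ i → fetch P (proj₁ c) ≡ just i × c′ ≡ execute i c
Step⇒execute (s-inc f)  = _ , f , refl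
Step⇒execute {c = pc , R} (s-decZ {r = r} f q) with R r in e
Step⇒execute {c = pc , R} (s-decZ {r = r} {j} {k} f refl) | .0 =
  dec r j k , f , lem
  where
  lem : (k , R) ≡ execute (dec r j k) (pc , R)
  lem rewrite e = refl
Step⇒execute {c = pc , R} (s-decS {r = r} {j} {k} {m} f q) = dec r j k , f , lem
  where
  lem : (j , update R r m) ≡ execute (dec r j k) (pc , R)
  lem rewrite q = refl
Step⇒execute (s-askY _ q) = ⊥-elim (¬InOracle∅ q)
Step⇒execute (s-askN f _) = _ , f , refl

Step-deterministic : ∀ {P a b c} → Step ∅ P a b → Step ∅ P a c → b ≡ c
Step-deterministic {a = a} s t with Step⇒execute s | Step⇒execute t
... | i , f , e | j , g , e′ =
  trans e (trans (cong (λ i → execute i a) (just-injective (trans (sym f) g))) (sym e′))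

-- With the empty oracle steps are deterministic, so of two runs from `a` one continues the other,
-- and no step leaves a halted configuration.
halted-last : ∀ {P a b h} → Star (Step ∅ P) a b → Star (Step ∅ P) a h →
  fetch P (proj₁ h) ≡ nothing → Star (Step ∅ P) b h
halted-last ε        t        q = t
halted-last (s ◅ _)  ε        q with Step⇒execute s
... | _ , f , _ with trans (sym q) f
... | ()
halted-last (s ◅ st) (t ◅ ts) q rewrite Step-deterministic s t = halted-last st ts q

module Machine {f : ℕ → ℕ} (F : Computable {1} (λ ρ → f (lookup ρ Fin.zero))) where

  private
    body = proj₁ (compile F (0 ∷ []) 1 (s≤s z≤n ∷ []))
    n = size body

    output : Cmd
    output = clear 0 ⨾ while 1 (incr 0)

    output-rule : ∀ R y → ⟪ update R 1 y ⟫ output ⟪ update (update R 1 0) 0 y ⟫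
    output-rule R y = seq-rule (clear-rule 0)
      (conseq (update-swap λ ()) (go y 0)
        (≈-trans (update-swap λ ()) (update-cong ≈-refl (+-identityʳ y))))
      where
      go : ∀ y x → ⟪ update (update R 0 x) 1 y ⟫ while 1 (incr 0) ⟪ update (update R 0 (y + x)) 1 0 ⟫
      go zero    x = while-zero refl
      go (suc y) x = while-suc refl
        (conseq update-overwrite incr-rule
          (≈-trans (update-swap λ ()) (update-cong update-overwrite refl)))
        (conseq ≈-refl (go y (suc x)) (update-cong (update-cong ≈-refl (+-suc y x)) refl))

    branching : Program
    -- On value 0 control reaches the `ask` at `1 + n`, which jumps to itself on either answer;
    -- otherwise `dec` has already stripped the `suc` from the value.
    branching = dec 1 (2 + n) (1 + n) ∷ ask 0 (1 + n) (1 + n) ∷ code output (2 + n)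

  machine : Program
  machine = code body 0 ++ branching

  private
    at-body : At machine 0 (code body 0) × At machine n branching
    at-body with At-++⁻ 0 (code body 0) {branching} (At-self machine)
    ... | a , b = a , subst (λ z → At machine z branching) (length-code body 0) b

    evaluates : ∀ x → ∃ λ S → Star (Step ∅ machine) (0 , initRegs x) (n , S) ×
      S ≈ update (initRegs x) 1 (f x)
    evaluates x = exec (proj₂ (compile F (0 ∷ []) 1 (s≤s z≤n ∷ [])) (initRegs x) zs)
                    machine 0 (initRegs x) (proj₁ at-body) ≈-refl
      where
      zs : ∀ i → 1 ≤ i → initRegs x i ≡ 0
      zs (suc i) _ = refl

    halt-pc : fetch machine (2 + n + size output) ≡ nothing
    -- 7 is the length of `branching`: two instructions and the five of `output`.
    halt-pc = fetch-end machine (trans (length-++ (code body 0))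
      (trans (cong (_+ 7) (length-code body 0)) (trans (+-comm n 7) (sym (cong (2 +_) (+-comm n 5))))))

    spins : ∀ {S h} → Star (Step ∅ machine) (1 + n , S) h → proj₁ h ≡ 1 + n
    spins ε        = refl
    spins (s ◅ st) with Step⇒execute s
    ... | i , g , e rewrite just-injective (trans (sym g) (proj₁ (proj₂ (proj₂ at-body)))) | e = spins st

  machine-sound : ∀ {x y} → f x ≡ suc y → Runs ∅ machine x y
  machine-sound {x} {y} e with evaluates x | proj₂ at-body
  ... | S , st , q | d₁ , _ , a
    with exec (output-rule (initRegs x) y) machine (2 + n) (update S 1 y) a
           (≈-trans (update-cong q refl) update-overwrite)
  ... | S′ , st′ , q′ = _ , S′ ,
    st ◅◅ (s-decS d₁ (trans (at q 1) (trans (update-eq (initRegs x) 1) e)) ◅ st′) ,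
    halt-pc , at q′ 0

  -- If `f x` is a successor, `machine-sound` supplies a halting run and determinism equates the
  -- outputs; if it is 0, every run is caught in the self-loop.
  machine-complete : ∀ {x y} → Runs ∅ machine x y → f x ≡ suc y
  machine-complete {x} {y} (pc , R , st , h , e) with f x in q
  ... | suc y′ with machine-sound q
  ... | pc′ , R′ , st′ , h′ , e′ with halted-last st st′ h′
  ... | ε = cong suc (trans (sym e′) e)
  ... | s ◅ _ with Step⇒execute s
  ... | _ , g , _ with trans (sym h) g
  ... | ()
  machine-complete {x} {y} (pc , R , st , h , e) | zero with evaluates x | proj₂ at-body
  ... | S , st₀ , p | d₁ , d₂ , _
    with halted-last (st₀ ◅◅ (s-decZ d₁ (trans (at p 1) (trans (update-eq (initRegs x) 1) q)) ◅ ε)) st h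
  ... | st₁ with trans (sym h) (trans (cong (fetch machine) (spins st₁)) d₂)
  ... | ()

-- Finite sums and numerical truth values

∑ : ℕ → (ℕ → ℕ) → ℕ
∑ zero    f = 0
∑ (suc n) f = ∑ n f + f n

∑-mono : ∀ n {f g} → (∀ i → i < n → f i ≤ g i) → ∑ n f ≤ ∑ n g
∑-mono zero    h = z≤n
∑-mono (suc n) h = +-mono-≤ (∑-mono n (λ i p → h i (m≤n⇒m≤1+n p))) (h n ≤-refl)

∑-cong : ∀ n {f g} → (∀ i → i < n → f i ≡ g i) → ∑ n f ≡ ∑ n g
∑-cong n h = ≤-antisym (∑-mono n (λ i p → ≤-reflexive (h i p)))
                       (∑-mono n (λ i p → ≤-reflexive (sym (h i p))))

∑-const : ∀ n c → ∑ n (λ _ → c) ≡ n * c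
∑-const zero    c = refl
∑-const (suc n) c = trans (cong (_+ c) (∑-const n c)) (+-comm (n * c) c)

∑-zero : ∀ n {f} → (∀ i → i < n → f i ≡ 0) → ∑ n f ≡ 0
∑-zero n h = trans (∑-cong n h) (trans (∑-const n 0) (*-zeroʳ n))

∑-split : ∀ m n f → ∑ (m + n) f ≡ ∑ m f + ∑ n (λ i → f (m + i))
∑-split m zero    f = trans (cong (λ k → ∑ k f) (+-identityʳ m)) (sym (+-identityʳ _))
∑-split m (suc n) f = trans (cong (λ k → ∑ k f) (+-suc m n))
  (trans (cong (_+ f (m + n)) (∑-split m n f)) (+-assoc (∑ m f) _ _))

∑-extend : ∀ {m n} f → m ≤ n → ∑ m f ≤ ∑ n f
∑-extend {m} {n} f p = subst (λ k → ∑ m f ≤ ∑ k f) (m+[n∸m]≡n p)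
  (≤-trans (m≤m+n _ _) (≤-reflexive (sym (∑-split m (n ∸ m) f))))

∑-term : ∀ {a n} f → a < n → f a ≤ ∑ n f
∑-term {a} f p = ≤-trans (m≤n+m (f a) (∑ a f)) (∑-extend f p)

∑-single : ∀ {a} n {f} → a < n → (∀ i → i < n → i ≢ a → f i ≡ 0) → ∑ n f ≡ f a
∑-single {a} (suc n) {f} p h with a ≟ n
... | yes refl = cong (_+ f n) (∑-zero n (λ i q → h i (m≤n⇒m≤1+n q) (<⇒≢ q)))
... | no ne = trans (cong₂ _+_ (∑-single n (≤∧≢⇒< (s≤s⁻¹ p) ne) (λ i q → h i (m≤n⇒m≤1+n q)))
                (h n ≤-refl (ne ∘ sym))) (+-identityʳ _)

∑-+ : ∀ n f g → ∑ n (λ i → f i + g i) ≡ ∑ n f + ∑ n g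
∑-+ zero    f g = refl
∑-+ (suc n) f g rewrite ∑-+ n f g =
  solve 4 (λ a b c d → a :+ b :+ (c :+ d) := a :+ c :+ (b :+ d)) refl (∑ n f) (∑ n g) (f n) (g n)

∑-*ˡ : ∀ n c f → ∑ n (λ i → c * f i) ≡ c * ∑ n f
∑-*ˡ zero    c f = sym (*-zeroʳ c)
∑-*ˡ (suc n) c f = trans (cong (_+ c * f n) (∑-*ˡ n c f)) (sym (*-distribˡ-+ c (∑ n f) (f n)))

∑-swap : ∀ m n (f : ℕ → ℕ → ℕ) → ∑ m (λ i → ∑ n (f i)) ≡ ∑ n (λ j → ∑ m (λ i → f i j))
∑-swap zero    n f = sym (∑-zero n (λ _ _ → refl))
∑-swap (suc m) n f = trans (cong (_+ ∑ n (f m)) (∑-swap m n f)) (sym (∑-+ n _ _))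

∑-positive : ∀ n {f} → 1 ≤ ∑ n f → ∃ λ i → i < n × 1 ≤ f i
∑-positive (suc n) {f} p with f n in e
... | suc _ = n , ≤-refl , subst (1 ≤_) (sym e) (s≤s z≤n)
... | zero with ∑-positive n (subst (1 ≤_) (+-identityʳ _) p)
... | i , q , r = i , m≤n⇒m≤1+n q , r

∑-unique : ∀ n {f} → (∀ i → i < n → f i ≤ 1) →
  (∀ i j → i < n → j < n → 1 ≤ f i → 1 ≤ f j → i ≡ j) → ∑ n f ≤ 1
∑-unique zero    h u = z≤n
∑-unique (suc n) {f} h u with f n in e
... | zero = subst (_≤ 1) (sym (+-identityʳ _))
  (∑-unique n (λ i p → h i (m≤n⇒m≤1+n p)) (λ i j p q → u i j (m≤n⇒m≤1+n p) (m≤n⇒m≤1+n q)))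
... | suc k = subst (λ z → z + suc k ≤ 1) (sym (∑-zero n vanish)) (subst (_≤ 1) e (h n ≤-refl))
  where
  vanish : ∀ i → i < n → f i ≡ 0
  vanish i p with f i in q
  ... | zero  = refl
  ... | suc _ = ⊥-elim (<⇒≢ p (u i n (m≤n⇒m≤1+n p) ≤-refl
    (subst (1 ≤_) (sym q) (s≤s z≤n)) (subst (1 ≤_) (sym e) (s≤s z≤n))))

-- Predicates are numbers 0 and 1, so that counting is summation, conjunction is multiplication, and
-- tests are computable by arithmetic.
[_≐_] : ℕ → ℕ → ℕ
[ zero  ≐ zero  ] = 1
[ zero  ≐ suc _ ] = 0
[ suc _ ≐ zero  ] = 0
[ suc a ≐ suc b ] = [ a ≐ b ]

[_⩽_] : ℕ → ℕ → ℕ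
[ zero  ⩽ _     ] = 1
[ suc _ ⩽ zero  ] = 0
[ suc a ⩽ suc b ] = [ a ⩽ b ]

≐-refl : ∀ a → [ a ≐ a ] ≡ 1
≐-refl zero    = refl
≐-refl (suc a) = ≐-refl a

≐⇒≡ : ∀ a b → 1 ≤ [ a ≐ b ] → a ≡ b
≐⇒≡ zero    zero    p = refl
≐⇒≡ (suc a) (suc b) p = cong suc (≐⇒≡ a b p)

≐≤1 : ∀ a b → [ a ≐ b ] ≤ 1
≐≤1 zero    zero    = ≤-refl
≐≤1 zero    (suc b) = z≤n
≐≤1 (suc a) zero    = z≤n
≐≤1 (suc a) (suc b) = ≐≤1 a b

⩽-intro : ∀ {a b} → a ≤ b → [ a ⩽ b ] ≡ 1
⩽-intro z≤n     = refl
⩽-intro (s≤s p) = ⩽-intro p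

⩽⇒≤ : ∀ a b → 1 ≤ [ a ⩽ b ] → a ≤ b
⩽⇒≤ zero    b       p = z≤n
⩽⇒≤ (suc a) (suc b) p = s≤s (⩽⇒≤ a b p)

⩽≤1 : ∀ a b → [ a ⩽ b ] ≤ 1
⩽≤1 zero    b       = ≤-refl
⩽≤1 (suc a) zero    = z≤n
⩽≤1 (suc a) (suc b) = ⩽≤1 a b

-- Computable functions

record Computable₁ (g : ℕ → ℕ) : Set where
  constructor fun₁
  field body₁ : Computable {1} (λ ρ → g (lookup ρ 0F))

record Computable₂ (g : ℕ → ℕ → ℕ) : Set where
  constructor fun₂
  field body₂ : Computable {2} (λ ρ → g (lookup ρ 0F) (lookup ρ 1F))

record Computable₃ (g : ℕ → ℕ → ℕ → ℕ) : Set where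
  constructor fun₃
  field body₃ : Computable {3} (λ ρ → g (lookup ρ 0F) (lookup ρ 1F) (lookup ρ 2F))

record Computable₄ (g : ℕ → ℕ → ℕ → ℕ → ℕ) : Set where
  constructor fun₄
  field body₄ : Computable {4} (λ ρ → g (lookup ρ 0F) (lookup ρ 1F) (lookup ρ 2F) (lookup ρ 3F))

app₁ : ∀ {m g} {a : Vec ℕ m → ℕ} → Computable₁ g → Computable a → Computable (λ ρ → g (a ρ))
app₁ (fun₁ G) A = letᶜ A (renameᶜ G (0F ∷ []))

app₂ : ∀ {m g} {a b : Vec ℕ m → ℕ} → Computable₂ g →
  Computable a → Computable b → Computable (λ ρ → g (a ρ) (b ρ))
app₂ (fun₂ G) A B = letᶜ A (letᶜ (weakenᶜ B) (renameᶜ G (1F ∷ 0F ∷ [])))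

app₃ : ∀ {m g} {a b c : Vec ℕ m → ℕ} → Computable₃ g →
  Computable a → Computable b → Computable c → Computable (λ ρ → g (a ρ) (b ρ) (c ρ))
app₃ (fun₃ G) A B C =
  letᶜ A (letᶜ (weakenᶜ B) (letᶜ (weakenᶜ (weakenᶜ C)) (renameᶜ G (2F ∷ 1F ∷ 0F ∷ []))))

app₄ : ∀ {m g} {a b c d : Vec ℕ m → ℕ} → Computable₄ g →
  Computable a → Computable b → Computable c → Computable d →
  Computable (λ ρ → g (a ρ) (b ρ) (c ρ) (d ρ))
app₄ (fun₄ G) A B C D = letᶜ A (letᶜ (weakenᶜ B) (letᶜ (weakenᶜ (weakenᶜ C))
  (letᶜ (weakenᶜ (weakenᶜ (weakenᶜ D))) (renameᶜ G (3F ∷ 2F ∷ 1F ∷ 0F ∷ [])))))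

v₀ : ∀ {m} → Computable {1 + m} (λ ρ → lookup ρ 0F)
v₀ = varᶜ 0F
v₁ : ∀ {m} → Computable {2 + m} (λ ρ → lookup ρ 1F)
v₁ = varᶜ 1F
v₂ : ∀ {m} → Computable {3 + m} (λ ρ → lookup ρ 2F)
v₂ = varᶜ 2F
v₃ : ∀ {m} → Computable {4 + m} (λ ρ → lookup ρ 3F)
v₃ = varᶜ 3F
v₄ : ∀ {m} → Computable {5 + m} (λ ρ → lookup ρ 4F)
v₄ = varᶜ 4F
v₅ : ∀ {m} → Computable {6 + m} (λ ρ → lookup ρ 5F)
v₅ = varᶜ 5F

constᶜ : ∀ {m} k → Computable {m} (λ _ → k)
constᶜ zero    = zeroᶜ
constᶜ (suc k) = sucᶜ (constᶜ k)

iterate : ℕ → ℕ → (ℕ → ℕ) → ℕ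
iterate zero    z s = z
iterate (suc n) z s = s (iterate n z s)

rec≡ : ∀ {z s} (f : ℕ → ℕ) → f 0 ≡ z → (∀ n → f (suc n) ≡ s n (f n)) → ∀ n → rec n z s ≡ f n
rec≡ f e₀ eₛ zero    = sym e₀
rec≡ {s = s} f e₀ eₛ (suc n) = trans (cong (s n) (rec≡ f e₀ eₛ n)) (sym (eₛ n))

+ᶜ : Computable₂ _+_
+ᶜ = fun₂ (ext (λ ρ → rec≡ (_+ lookup ρ 1F) refl (λ _ → refl) (lookup ρ 0F)) (recᶜ v₀ v₁ (sucᶜ v₀)))

*ᶜ : Computable₂ _*_
*ᶜ = fun₂ (ext (λ ρ → rec≡ (_* lookup ρ 1F) refl (λ _ → refl) (lookup ρ 0F)) (recᶜ v₀ zeroᶜ (app₂ +ᶜ v₃ v₀)))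

∸ᶜ : Computable₂ _∸_
∸ᶜ = fun₂ (ext (λ ρ → rec≡ (lookup ρ 0F ∸_) refl (λ n → sym (pred[m∸n]≡m∸[1+n] (lookup ρ 0F) n)) (lookup ρ 1F))
       (recᶜ v₁ v₀ (predᶜ v₀)))

^ᶜ : Computable₂ _^_
^ᶜ = fun₂ (ext (λ ρ → rec≡ (lookup ρ 0F ^_) refl (λ _ → refl) (lookup ρ 1F)) (recᶜ v₁ (constᶜ 1) (app₂ *ᶜ v₂ v₀)))

⩽ᶜ : Computable₂ [_⩽_]
⩽ᶜ = fun₂ (ext (λ ρ → go (lookup ρ 0F) (lookup ρ 1F)) (app₂ ∸ᶜ (constᶜ 1) (app₂ ∸ᶜ v₀ v₁)))
  where
  go : ∀ a b → 1 ∸ (a ∸ b) ≡ [ a ⩽ b ]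
  go zero    zero    = refl
  go zero    (suc b) = refl
  go (suc a) zero    = 0∸n≡0 a
  go (suc a) (suc b) = go a b

≐ᶜ : Computable₂ [_≐_]
≐ᶜ = fun₂ (ext (λ ρ → go (lookup ρ 0F) (lookup ρ 1F)) (app₂ *ᶜ (app₂ ⩽ᶜ v₀ v₁) (app₂ ⩽ᶜ v₁ v₀)))
  where
  go : ∀ a b → [ a ⩽ b ] * [ b ⩽ a ] ≡ [ a ≐ b ]
  go zero    zero    = refl
  go zero    (suc b) = refl
  go (suc a) zero    = refl
  go (suc a) (suc b) = go a b

cond : ℕ → ℕ → ℕ → ℕ
cond zero    a b = b
cond (suc _) a b = a

condᶜ : Computable₃ cond
condᶜ = fun₃ (ext (λ ρ → rec≡ (λ c → cond c (lookup ρ 1F) (lookup ρ 2F)) refl (λ _ → refl) (lookup ρ 0F))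
  (recᶜ v₀ v₂ v₃))

∑ᶜ : ∀ {m} {n : Vec ℕ m → ℕ} {f : Vec ℕ (suc m) → ℕ} → Computable n → Computable f →
  Computable (λ ρ → ∑ (n ρ) (λ i → f (i ∷ ρ)))
∑ᶜ {n = n} {f} N F = ext (λ ρ → rec≡ (λ k → ∑ k (λ i → f (i ∷ ρ))) refl (λ _ → refl) (n ρ))
  (recᶜ N zeroᶜ (app₂ +ᶜ v₀ (weakenᶜ F)))

-- The recursion step uses ⌊(n + 1)/2⌋ = ⌈n/2⌉ = n - ⌊n/2⌋.
halfᶜ : Computable₁ ⌊_/2⌋
halfᶜ = fun₁ (ext (λ ρ → rec≡ ⌊_/2⌋ refl (λ n → trans (sym (m+n∸m≡n ⌊ n /2⌋ ⌈ n /2⌉)) (cong (_∸ ⌊ n /2⌋) (⌊n/2⌋+⌈n/2⌉≡n n)))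
  (lookup ρ 0F)) (recᶜ v₀ zeroᶜ (app₂ ∸ᶜ v₁ v₀)))

-- Binary digits and computable codes of prefixes

bit : Bool → ℕ
bit false = 0
bit true  = 1

odd : ℕ → Bool
odd zero    = false
odd (suc n) = not (odd n)

oddᶜ : Computable₁ (bit ∘ odd)
oddᶜ = fun₁ (ext (λ ρ → rec≡ (bit ∘ odd) refl (λ n → go (odd n)) (lookup ρ 0F))
  (recᶜ v₀ zeroᶜ (app₂ ∸ᶜ (constᶜ 1) v₀)))
  where
  go : ∀ b → bit (not b) ≡ 1 ∸ bit b
  go false = refl
  go true  = refl

-- The binary digits of w, least significant first.
digits : ℕ → BitSeq
digits w k = odd (iterate k w ⌊_/2⌋)

digitᶜ : Computable₂ (λ w k → bit (digits w k))
digitᶜ = fun₂ (app₁ oddᶜ (ext (λ ρ → rec≡ (λ k → iterate k (lookup ρ 0F) ⌊_/2⌋) refl (λ _ → refl) (lookup ρ 1F))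
  (recᶜ v₁ v₀ (app₁ halfᶜ v₀))))

bits-suc : ∀ β n → bits β (suc n) ≡ β 0 ∷ bits (β ∘ suc) n
bits-suc β n = cong (β 0 ∷_) (trans (map-applyUpTo suc β n) (sym (map-upTo (β ∘ suc) n)))

bits-cong : ∀ n {β γ} → (∀ k → k < n → β k ≡ γ k) → bits β n ≡ bits γ n
bits-cong zero    h = refl
bits-cong (suc n) {β} {γ} h = trans (bits-suc β n)
  (trans (cong₂ _∷_ (h 0 (s≤s z≤n)) (bits-cong n (λ k p → h (suc k) (s≤s p)))) (sym (bits-suc γ n)))

length-bits : ∀ β n → length (bits β n) ≡ n
length-bits β n = trans (length-map β (upTo n)) (length-upTo n)

∑-suc : ∀ n f → ∑ (suc n) f ≡ f 0 + ∑ n (f ∘ suc)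
∑-suc n f = ∑-split 1 n f

-- `encode` is bijective base two: digits 1 and 2, least significant first. The explicit sum is what
-- `bitsᶜ` computes.
encode-bits : ∀ n β → encode (bits β n) ≡ ∑ n (λ i → suc (bit (β i)) * 2 ^ i)
encode-bits zero    β = refl
encode-bits (suc n) β = begin
  encode (bits β (suc n))                              ≡⟨ cong encode (bits-suc β n) ⟩
  encode (β 0 ∷ bits (β ∘ suc) n)                      ≡⟨ encode-∷ (β 0) _ ⟩
  suc (bit (β 0)) + 2 * encode (bits (β ∘ suc) n)      ≡⟨ cong (λ z → suc (bit (β 0)) + 2 * z) (encode-bits n (β ∘ suc)) ⟩
  suc (bit (β 0)) + 2 * ∑ n (λ i → suc (bit (β (suc i))) * 2 ^ i)
    ≡⟨ cong (suc (bit (β 0)) +_) (sym (∑-*ˡ n 2 _)) ⟩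
  suc (bit (β 0)) + ∑ n (λ i → 2 * (suc (bit (β (suc i))) * 2 ^ i))
    ≡⟨ cong₂ _+_ (sym (*-identityʳ (suc (bit (β 0)))))
        (∑-cong n (λ i _ → solve 2 (λ a b → con 2 :* (a :* b) := a :* (con 2 :* b)) refl (suc (bit (β (suc i)))) (2 ^ i))) ⟩
  suc (bit (β 0)) * 1 + ∑ n (λ i → suc (bit (β (suc i))) * 2 ^ suc i)
    ≡⟨ sym (∑-suc n _) ⟩
  ∑ (suc n) (λ i → suc (bit (β i)) * 2 ^ i)            ∎
  where
  open ≡-Reasoning
  encode-∷ : ∀ b s → encode (b ∷ s) ≡ suc (bit b) + 2 * encode s
  encode-∷ false s = refl
  encode-∷ true  s = refl

bitsᶜ : ∀ {m} {n : Vec ℕ m → ℕ} {g : Vec ℕ (suc m) → ℕ} (β : Vec ℕ m → BitSeq) →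
  (∀ ρ i → g (i ∷ ρ) ≡ bit (β ρ i)) → Computable n → Computable g →
  Computable (λ ρ → encode (bits (β ρ) (n ρ)))
bitsᶜ {n = n} β e N G = ext
  (λ ρ → trans (∑-cong (n ρ) (λ i _ → cong (λ d → suc d * 2 ^ i) (e ρ i))) (sym (encode-bits (n ρ) (β ρ))))
  (∑ᶜ N (app₂ *ᶜ (sucᶜ G) (app₂ ^ᶜ (constᶜ 2) v₀)))

-- Cantor pairing

triangle : ℕ → ℕ
triangle n = ∑ (suc n) id

abstract
  pair : ℕ → ℕ → ℕ
  pair a b = triangle (a + b) + a

  -- Unpairing is exhaustive search written as a sum: injectivity of `pair` leaves at most one
  -- nonzero summand, and `pair-bound` puts it within range.
  fst snd : ℕ → ℕ
  fst z = ∑ (suc z) λ a → ∑ (suc z) λ b → [ pair a b ≐ z ] * a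
  snd z = ∑ (suc z) λ a → ∑ (suc z) λ b → [ pair a b ≐ z ] * b

  pair-sum : ∀ {a b c d} → a + b < c + d → pair a b < pair c d
  pair-sum {a} {b} {c} {d} p = begin-strict
    triangle (a + b) + a             ≤⟨ +-monoʳ-≤ (triangle (a + b)) (m≤m+n a b) ⟩
    triangle (a + b) + (a + b)       <⟨ +-monoʳ-< (triangle (a + b)) ≤-refl ⟩
    triangle (suc (a + b))           ≤⟨ ∑-extend id (s≤s p) ⟩
    triangle (c + d)                 ≤⟨ m≤m+n _ c ⟩
    triangle (c + d) + c             ∎
    where open ≤-Reasoning

  pair-injective : ∀ {a b c d} → pair a b ≡ pair c d → a ≡ c × b ≡ d
  pair-injective {a} {b} {c} {d} e with <-cmp (a + b) (c + d)
  ... | tri< p _ _ = ⊥-elim (<⇒≢ (pair-sum {a} {b} {c} {d} p) e)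
  ... | tri> _ _ p = ⊥-elim (<⇒≢ (pair-sum {c} {d} {a} {b} p) (sym e))
  ... | tri≈ _ q _ with +-cancelˡ-≡ (triangle (a + b)) a c (trans e (cong (λ z → triangle z + c) (sym q)))
  ... | refl = refl , +-cancelˡ-≡ a b d q

  pair-bound : ∀ a b → a + b ≤ pair a b
  pair-bound a b = ≤-trans (m≤n+m (a + b) (∑ (a + b) id)) (m≤m+n (triangle (a + b)) a)

  search-pair : ∀ a b (f : ℕ → ℕ → ℕ) → let z = pair a b in
    ∑ (suc z) (λ x → ∑ (suc z) λ y → [ pair x y ≐ z ] * f x y) ≡ f a b
  search-pair a b f = begin
    ∑ (suc z) (λ x → ∑ (suc z) λ y → [ pair x y ≐ z ] * f x y)
      ≡⟨ ∑-single (suc z) (s≤s (≤-trans (m≤m+n a b) (pair-bound a b)))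
          (λ x _ ne → ∑-zero (suc z) (λ y _ → vanish x y (ne ∘ proj₁))) ⟩
    ∑ (suc z) (λ y → [ pair a y ≐ z ] * f a y)
      ≡⟨ ∑-single (suc z) (s≤s (≤-trans (m≤n+m b a) (pair-bound a b)))
          (λ y _ ne → vanish a y (ne ∘ proj₂)) ⟩
    [ z ≐ z ] * f a b  ≡⟨ cong (_* f a b) (≐-refl z) ⟩
    1 * f a b          ≡⟨ *-identityˡ (f a b) ⟩
    f a b              ∎
    where
    open ≡-Reasoning
    z : ℕ
    z = pair a b
    vanish : ∀ x y → ¬ (x ≡ a × y ≡ b) → [ pair x y ≐ z ] * f x y ≡ 0
    vanish x y ne with [ pair x y ≐ z ] in e
    ... | zero  = refl
    ... | suc _ = ⊥-elim (ne (pair-injective {x} {y} {a} {b} (≐⇒≡ _ _ (subst (1 ≤_) (sym e) (s≤s z≤n)))))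

  fst-pair : ∀ a b → fst (pair a b) ≡ a
  fst-pair a b = search-pair a b (λ x _ → x)

  snd-pair : ∀ a b → snd (pair a b) ≡ b
  snd-pair a b = search-pair a b (λ _ y → y)

  pairᶜ : Computable₂ pair
  pairᶜ = fun₂ (app₂ +ᶜ (∑ᶜ (sucᶜ (app₂ +ᶜ v₀ v₁)) v₀) v₀)

  fstᶜ : Computable₁ fst
  fstᶜ = fun₁ (∑ᶜ (sucᶜ v₀) (∑ᶜ (sucᶜ v₁) (app₂ *ᶜ (app₂ ≐ᶜ (app₂ pairᶜ v₁ v₀) v₂) v₁)))

  sndᶜ : Computable₁ snd
  sndᶜ = fun₁ (∑ᶜ (sucᶜ v₀) (∑ᶜ (sucᶜ v₁) (app₂ *ᶜ (app₂ ≐ᶜ (app₂ pairᶜ v₁ v₀) v₂) v₀)))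

  -- Register contents will be coded as infinite lists by nested pairing; since 0 unpairs to two
  -- zeros, the code 0 stands for registers that are all zero.
  fst-0 : fst 0 ≡ 0
  fst-0 = refl

  snd-0 : snd 0 ≡ 0
  snd-0 = refl

-- Bounded simulation of an oracle machine on numerical codes of its
-- configurations; χ is the characteristic function of the oracle.

get : ℕ → ℕ → ℕ
get zero    X = fst X
get (suc i) X = get i (snd X)

put : ℕ → ℕ → ℕ → ℕ
put zero    v X = pair v (snd X)
put (suc i) v X = pair (fst X) (put i v (snd X))

get-put : ∀ i r v X {R} → (∀ i → get i X ≡ R i) → get i (put r v X) ≡ update R r v i
get-put i r v X {R} h with i ≟ r
... | yes refl = same r X
  where
  same : ∀ r X → get r (put r v X) ≡ v
  same zero    X = fst-pair v (snd X)
  same (suc r) X = trans (cong (get r) (snd-pair _ _)) (same r (snd X))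
... | no ne = trans (other i r X ne) (h i)
  where
  other : ∀ i r X → i ≢ r → get i (put r v X) ≡ get i X
  other zero    zero    X ne = ⊥-elim (ne refl)
  other zero    (suc r) X ne = fst-pair _ _
  other (suc i) zero    X ne = cong (get i) (snd-pair _ _)
  other (suc i) (suc r) X ne = trans (cong (get i) (snd-pair _ _)) (other i r (snd X) (ne ∘ cong suc))

stepInstr : (ℕ → ℕ) → Instr → ℕ → ℕ
stepInstr χ (inc r j)   X = pair j (put r (suc (get r X)) X)
stepInstr χ (dec r j k) X = cond (get r X) (pair j (put r (pred (get r X)) X)) (pair k X)
stepInstr χ (ask r j k) X = cond (χ (get r X)) (pair j X) (pair k X)

-- Past the end of the program the configuration is returned unchanged. A halted run is thus a fixed
-- point of `step`, which makes `halts` and `result` stable in time.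
select : (ℕ → ℕ) → Program → ℕ → ℕ → ℕ
select χ []       pc Z = Z
select χ (i ∷ is) pc Z = cond pc (select χ is (pred pc) Z) (stepInstr χ i (snd Z))

step : Program → (ℕ → ℕ) → ℕ → ℕ
step P χ Z = select χ P (fst Z) Z

run : Program → (ℕ → ℕ) → ℕ → ℕ → ℕ
run P χ x t = iterate t (pair 0 (pair x 0)) (step P χ)

opaque

  halts : Program → (ℕ → ℕ) → ℕ → ℕ → ℕ
  halts P χ x t = [ length P ⩽ fst (run P χ x t) ]

  result : Program → (ℕ → ℕ) → ℕ → ℕ → ℕ
  result P χ x t = get 0 (snd (run P χ x t))

-- Membership need not be decidable; the two implications match the rules `s-askY` and `s-askN`.
Decides : (ℕ → ℕ) → Oracle → Set
Decides χ A = ∀ v → (InOracle A v → χ v ≡ 1) × (¬ InOracle A v → χ v ≡ 0)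

Represents : Config → ℕ → Set
Represents (pc , R) Z = fst Z ≡ pc × (∀ i → get i (snd Z) ≡ R i)

represents-pair : ∀ {pc R X} → (∀ i → get i X ≡ R i) → Represents (pc , R) (pair pc X)
represents-pair h = fst-pair _ _ , λ i → trans (cong (get i) (snd-pair _ _)) (h i)

represents-init : ∀ x → Represents (0 , initRegs x) (pair 0 (pair x 0))
represents-init x = represents-pair λ where
    zero    → fst-pair x 0
    (suc i) → trans (cong (get i) (snd-pair x 0)) (get-0 i)
  where
  get-0 : ∀ i → get i 0 ≡ 0
  get-0 zero    = fst-0
  get-0 (suc i) = trans (cong (get i) snd-0) (get-0 i)

select-fetch : ∀ χ P {pc i} Z → fetch P pc ≡ just i → select χ P pc Z ≡ stepInstr χ i (snd Z)
select-fetch χ (i ∷ P) {zero}   Z refl = refl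
select-fetch χ (i ∷ P) {suc pc} Z e    = select-fetch χ P Z e

select-halted : ∀ χ P {pc} Z → length P ≤ pc → select χ P pc Z ≡ Z
select-halted χ []      Z p       = refl
select-halted χ (i ∷ P) Z (s≤s p) = select-halted χ P Z p

fetch-nothing : ∀ P {pc} → fetch P pc ≡ nothing → length P ≤ pc
fetch-nothing []      e          = z≤n
fetch-nothing (i ∷ P) {suc pc} e = s≤s (fetch-nothing P e)

fetch-halted : ∀ P {pc} → length P ≤ pc → fetch P pc ≡ nothing
fetch-halted []      p       = refl
fetch-halted (i ∷ P) (s≤s p) = fetch-halted P p

step-represents : ∀ {A P χ c c′ Z} → Decides χ A → Step A P c c′ →
  Represents c Z → Represents c′ (step P χ Z)
step-represents {P = P} {χ} {c} {c′} {Z} D s (refl , h) = go s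
  where
  X = snd Z
  via : ∀ {i Y} → fetch P (fst Z) ≡ just i → stepInstr χ i X ≡ Y → Represents c′ Y → Represents c′ (step P χ Z)
  via f refl = subst (Represents c′) (sym (select-fetch χ P Z f))
  go : Step _ P (fst Z , proj₂ c) c′ → Represents c′ (step P χ Z)
  go (s-inc {r = r} {j} f) = via f refl (represents-pair
    (λ i → trans (get-put i r (suc (get r X)) X h) (cong (λ v → update _ r (suc v) i) (h r))))
  go (s-decZ {r = r} {j} {k} f q) =
    via f (cong (λ v → cond v (pair j (put r (pred (get r X)) X)) (pair k X)) (trans (h r) q)) (represents-pair h)
  go (s-decS {r = r} {j} {k} {m} f q) =
    via f (cong (λ v → cond v (pair j (put r (pred v) X)) (pair k X)) (trans (h r) q))
      (represents-pair (λ i → get-put i r m X h))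
  go (s-askY {r = r} {j} {k} f q) =
    via f (cong (λ v → cond v (pair j X) (pair k X)) (trans (cong χ (h r)) (proj₁ (D _) q))) (represents-pair h)
  go (s-askN {r = r} {j} {k} f q) =
    via f (cong (λ v → cond v (pair j X) (pair k X)) (trans (cong χ (h r)) (proj₂ (D _) q))) (represents-pair h)

iterate-shift : ∀ n z s → iterate n (s z) s ≡ s (iterate n z s)
iterate-shift zero    z s = refl
iterate-shift (suc n) z s = cong s (iterate-shift n z s)

star-represents : ∀ {A P χ c c′ Z} → Decides χ A → Star (Step A P) c c′ →
  Represents c Z → ∃ λ t → Represents c′ (iterate t Z (step P χ))
star-represents D ε        h = 0 , h
star-represents {P = P} {χ} {c′ = c′} {Z} D (s ◅ st) h
  with star-represents D st (step-represents D s h)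
... | t , h′ = suc t , subst (Represents c′) (iterate-shift t Z (step P χ)) h′

opaque
  unfolding halts result

  Runs⇒halts : ∀ {A P χ x y} → Decides χ A → Runs A P x y →
    ∃ λ t → halts P χ x t ≡ 1 × result P χ x t ≡ y
  Runs⇒halts {P = P} D (pc , R , st , h , e) with star-represents D st (represents-init _)
  ... | t , p , q = t , ⩽-intro (subst (length P ≤_) (sym p) (fetch-nothing P h)) , trans (q 0) e

  run-stable : ∀ {P χ x t} → halts P χ x t ≡ 1 → ∀ {t′} → t ≤ t′ → run P χ x t′ ≡ run P χ x t
  run-stable {P} {χ} {x} {t} h {t′} p = subst (λ z → run P χ x z ≡ run P χ x t) (m∸n+n≡m p) (go (t′ ∸ t))
    where
    go : ∀ k → run P χ x (k + t) ≡ run P χ x t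
    go zero    = refl
    go (suc k) = trans (cong (step P χ) (go k))
      (select-halted χ P _ (⩽⇒≤ (length P) _ (≤-reflexive (sym h))))

  halts-stable : ∀ {P χ x t} → halts P χ x t ≡ 1 → ∀ {t′} → t ≤ t′ → halts P χ x t′ ≡ 1
  halts-stable {P} {χ} h p = trans (cong (λ Z → [ length P ⩽ fst Z ]) (run-stable {P} {χ} h p)) h

  result-stable : ∀ {P χ x t} → halts P χ x t ≡ 1 → ∀ {t′} → t ≤ t′ → result P χ x t′ ≡ result P χ x t
  result-stable {P} {χ} h p = cong (λ Z → get 0 (snd Z)) (run-stable {P} {χ} h p)

no-oracle : ℕ → ℕ
no-oracle _ = 0

no-oracle-decides : Decides no-oracle ∅
no-oracle-decides v = (λ p → ⊥-elim (¬InOracle∅ p)) , λ _ → refl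

progress : ∀ {P pc i} R → fetch P pc ≡ just i → ∃ λ c → Step ∅ P (pc , R) c
progress {i = inc r j}   R f = _ , s-inc f
progress {i = dec r j k} R f with R r in e
... | zero  = _ , s-decZ f e
... | suc m = _ , s-decS f e
progress {i = ask r j k} R f = _ , s-askN f ¬InOracle∅

run-reaches : ∀ P x t → ∃ λ c → Star (Step ∅ P) (0 , initRegs x) c × Represents c (run P no-oracle x t)
run-reaches P x zero    = _ , ε , represents-init x
run-reaches P x (suc t) with run-reaches P x t
... | (pc , R) , st , h with fetch P pc in f
... | nothing = _ , st , subst (Represents (pc , R))
  (sym (select-halted no-oracle P _ (subst (length P ≤_) (sym (proj₁ h)) (fetch-nothing P f)))) h
... | just i with progress R f
... | c , s = c , st ◅◅ (s ◅ ε) , step-represents no-oracle-decides s h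

opaque
  unfolding halts

  -- With the empty oracle every simulated step can be carried out, so simulated halting is genuine.
  -- Prefix-freeness of `Dom V` thereby passes to the programs that the simulation sees halting.
  halts⇒Runs : ∀ {P x t} → halts P no-oracle x t ≡ 1 → ∃ λ y → Runs ∅ P x y
  halts⇒Runs {P} {x} {t} h with run-reaches P x t
  ... | (pc , R) , st , (p , q) = R 0 , pc , R , st ,
    fetch-halted P (subst (length P ≤_) p (⩽⇒≤ (length P) _ (≤-reflexive (sym h)))) , refl

  halts≤1 : ∀ P χ x t → halts P χ x t ≤ 1
  halts≤1 P χ x t = ⩽≤1 (length P) _

getᶜ : ∀ i → Computable₁ (get i)
getᶜ zero    = fstᶜ
getᶜ (suc i) = fun₁ (app₁ (getᶜ i) (app₁ sndᶜ v₀))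

putᶜ : ∀ i → Computable₂ (put i)
putᶜ zero    = fun₂ (app₂ pairᶜ v₀ (app₁ sndᶜ v₁))
putᶜ (suc i) = fun₂ (app₂ pairᶜ (app₁ fstᶜ v₁) (app₂ (putᶜ i) v₀ (app₁ sndᶜ v₁)))

-- The first two arguments of `χ` are parameters of the oracle, later n and a time bound; the
-- simulation must be computable uniformly in them.
module _ {χ : ℕ → ℕ → ℕ → ℕ} (χᶜ : Computable₃ χ) where

  stepInstrᶜ : ∀ i → Computable₃ (λ a b X → stepInstr (χ a b) i X)
  stepInstrᶜ (inc r j)   = fun₃ (app₂ pairᶜ (constᶜ j) (app₂ (putᶜ r) (sucᶜ (app₁ (getᶜ r) v₂)) v₂))
  stepInstrᶜ (dec r j k) = fun₃ (app₃ condᶜ (app₁ (getᶜ r) v₂)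
    (app₂ pairᶜ (constᶜ j) (app₂ (putᶜ r) (predᶜ (app₁ (getᶜ r) v₂)) v₂))
    (app₂ pairᶜ (constᶜ k) v₂))
  stepInstrᶜ (ask r j k) = fun₃ (app₃ condᶜ (app₃ χᶜ v₀ v₁ (app₁ (getᶜ r) v₂))
    (app₂ pairᶜ (constᶜ j) v₂) (app₂ pairᶜ (constᶜ k) v₂))

  selectᶜ : ∀ P → Computable₄ (λ a b pc Z → select (χ a b) P pc Z)
  selectᶜ []      = fun₄ v₃
  selectᶜ (i ∷ P) = fun₄ (app₃ condᶜ v₂ (app₄ (selectᶜ P) v₀ v₁ (predᶜ v₂) v₃)
    (app₃ (stepInstrᶜ i) v₀ v₁ (app₁ sndᶜ v₃)))

  runᶜ : ∀ P → Computable₄ (λ a b x t → run P (χ a b) x t)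
  runᶜ P =
    fun₄ (ext (λ ρ → rec≡ (run P (χ (lookup ρ 0F) (lookup ρ 1F)) (lookup ρ 2F)) refl (λ _ → refl) (lookup ρ 3F))
    (recᶜ v₃ (app₂ pairᶜ zeroᶜ (app₂ pairᶜ v₂ zeroᶜ))
      (app₄ (selectᶜ P) v₂ v₃ (app₁ fstᶜ v₀) v₀)))

  opaque
    unfolding halts result

    haltsᶜ : ∀ P → Computable₄ (λ a b x t → halts P (χ a b) x t)
    haltsᶜ P = fun₄ (app₂ ⩽ᶜ (constᶜ (length P)) (app₁ fstᶜ (app₄ (runᶜ P) v₀ v₁ v₂ v₃)))

    resultᶜ : ∀ P → Computable₄ (λ a b x t → result P (χ a b) x t)
    resultᶜ P = fun₄ (app₁ fstᶜ (app₁ sndᶜ (app₄ (runᶜ P) v₀ v₁ v₂ v₃)))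

-- Codes, lengths and prefixes of strings

encode-false≢true : ∀ {x y} → suc (2 * x) ≢ suc (suc (2 * y))
encode-false≢true {x} {y} e = go x y (suc-injective e)
  where
  go : ∀ x y → 2 * x ≢ suc (2 * y)
  go (suc x) (suc y) e = go x y (suc-injective (suc-injective
    (trans (sym (*-suc 2 x)) (trans e (cong suc (*-suc 2 y))))))
  go (suc x) zero    e with trans (sym (*-suc 2 x)) e
  ... | ()

encode-injective : ∀ {s t} → encode s ≡ encode t → s ≡ t
encode-injective {[]}        {[]}        e = refl
encode-injective {[]}        {false ∷ t} ()
encode-injective {[]}        {true ∷ t}  ()
encode-injective {false ∷ s} {[]}        ()
encode-injective {true ∷ s}  {[]}        ()
encode-injective {false ∷ s} {false ∷ t} e = cong (false ∷_) (encode-injective (*-cancelˡ-≡ _ _ 2 (suc-injective e)))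
encode-injective {false ∷ s} {true ∷ t}  e = ⊥-elim (encode-false≢true {encode s} {encode t} e)
encode-injective {true ∷ s}  {false ∷ t} e = ⊥-elim (encode-false≢true {encode t} {encode s} (sym e))
encode-injective {true ∷ s}  {true ∷ t}  e =
  cong (true ∷_) (encode-injective (*-cancelˡ-≡ _ _ 2 (suc-injective (suc-injective e))))

encode-surjective : ∀ y → ∃ λ s → encode s ≡ y
encode-surjective zero = [] , refl
encode-surjective (suc y) with encode-surjective y
... | s , refl = next s , encode-next s
  where
  next : Str → Str
  next []          = false ∷ []
  next (false ∷ s) = true ∷ s
  next (true ∷ s)  = false ∷ next s
  encode-next : ∀ s → encode (next s) ≡ suc (encode s)
  encode-next []          = refl
  encode-next (false ∷ s) = refl
  encode-next (true ∷ s)  = cong suc (trans (cong (2 *_) (encode-next s)) (*-suc 2 (encode s)))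

length≤encode : ∀ s → length s ≤ encode s
length≤encode []          = z≤n
length≤encode (false ∷ s) = s≤s (≤-trans (length≤encode s) (m≤n*m (encode s) 2))
length≤encode (true ∷ s)  = s≤s (m≤n⇒m≤1+n (≤-trans (length≤encode s) (m≤n*m (encode s) 2)))

-- Codes are ordered by length: those of length ℓ run from 2^ℓ - 1 to 2^(ℓ+1) - 2. With
-- `encode-upper` this turns a bound on the length into a comparison of numbers.
encode-lower : ∀ s → 2 ^ length s ≤ suc (encode s)
encode-lower []          = ≤-refl
encode-lower (false ∷ s) = ≤-trans (*-monoʳ-≤ 2 (encode-lower s)) (≤-reflexive (*-suc 2 (encode s)))
encode-lower (true ∷ s)  = m≤n⇒m≤1+n (≤-trans (*-monoʳ-≤ 2 (encode-lower s)) (≤-reflexive (*-suc 2 (encode s))))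

encode-upper : ∀ s → suc (encode s) < 2 ^ suc (length s)
encode-upper []      = ≤-refl
encode-upper (b ∷ s) = ≤-trans (last b) (*-monoʳ-≤ 2 (encode-upper s))
  where
  double : 2 * suc (suc (encode s)) ≡ 4 + 2 * encode s
  double = trans (*-suc 2 (suc (encode s))) (cong (suc ∘ suc) (*-suc 2 (encode s)))
  last : ∀ b → suc (suc (encode (b ∷ s))) ≤ 2 * suc (suc (encode s))
  last false = ≤-trans (n≤1+n _) (≤-reflexive (sym double))
  last true  = ≤-reflexive (sym double)

length≤⇒encode< : ∀ {s n} → length s ≤ n → suc (encode s) < 2 ^ suc n
length≤⇒encode< {s} p = <-≤-trans (encode-upper s) (^-monoʳ-≤ 2 (s≤s p))

encode<⇒length≤ : ∀ {s n} → suc (encode s) < 2 ^ suc n → length s ≤ n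
encode<⇒length≤ {s} {n} p = ≮⇒≥ λ q →
  <⇒≱ p (≤-trans (^-monoʳ-≤ 2 q) (encode-lower s))

≼-length : ∀ {p q} → p ≼ q → length p ≤ length q
≼-length {p} (r , refl) = subst (length p ≤_) (sym (length-++ p)) (m≤m+n _ _)

≼-equal-length : ∀ {p q} → p ≼ q → length p ≡ length q → p ≡ q
≼-equal-length {p} ([] , refl) e = sym (++-identityʳ p)
≼-equal-length {p} (x ∷ r , refl) e =
  ⊥-elim (m≢1+m+n (length p) (trans e (trans (length-++ p) (+-suc (length p) (length r)))))

bits-≼ : ∀ {m n} β → m ≤ n → bits β m ≼ bits β n
bits-≼ {n = n} β z≤n = bits β n , refl
bits-≼ {suc m} {suc n} β (s≤s p) with bits-≼ (β ∘ suc) p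
... | r , e = r , trans (cong (_++ r) (bits-suc β m)) (trans (cong (β 0 ∷_) e) (sym (bits-suc β n)))

bits-agree : ∀ n {β γ} → bits β n ≡ bits γ n → ∀ k → k < n → β k ≡ γ k
bits-agree (suc n) {β} {γ} e k p with ∷-injective (trans (sym (bits-suc β n)) (trans e (bits-suc γ n)))
bits-agree (suc n) e zero    p       | a , _ = a
bits-agree (suc n) e (suc k) (s≤s p) | _ , b = bits-agree n b k p

-- Numbers below 2^n as words of length n

half-double : ∀ b w → ⌊ bit b + 2 * w /2⌋ ≡ w
half-double false zero = refl
half-double true  zero = refl
half-double b (suc w) =
  trans (cong ⌊_/2⌋ (solve 2 (λ b w → b :+ con 2 :* (con 1 :+ w) := con 2 :+ (b :+ con 2 :* w)) refl (bit b) w))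
  (cong suc (half-double b w))

odd-double : ∀ b w → odd (bit b + 2 * w) ≡ b
odd-double false zero = refl
odd-double true  zero = refl
odd-double b (suc w) =
  trans (cong odd (solve 2 (λ b w → b :+ con 2 :* (con 1 :+ w) := con 2 :+ (b :+ con 2 :* w)) refl (bit b) w))
  (trans (not-involutive _) (odd-double b w))

double-half : ∀ w → w ≡ bit (odd w) + 2 * ⌊ w /2⌋
double-half zero = refl
double-half (suc zero) = refl
double-half (suc (suc w)) = begin
  2 + w                                     ≡⟨ cong (2 +_) (double-half w) ⟩
  2 + (bit (odd w) + 2 * ⌊ w /2⌋)
    ≡⟨ solve 2 (λ b h → con 2 :+ (b :+ con 2 :* h) := b :+ con 2 :* (con 1 :+ h)) refl (bit (odd w)) ⌊ w /2⌋ ⟩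
  bit (odd w) + 2 * suc ⌊ w /2⌋
    ≡⟨ cong (λ b → bit b + 2 * suc ⌊ w /2⌋) (sym (not-involutive (odd w))) ⟩
  bit (odd (2 + w)) + 2 * suc ⌊ w /2⌋       ∎
  where open ≡-Reasoning

half-< : ∀ {w m} → w < 2 * m → ⌊ w /2⌋ < m
half-< {w} {m} p =
  *-cancelˡ-< 2 _ _ (≤-<-trans (≤-trans (m≤n+m _ (bit (odd w))) (≤-reflexive (sym (double-half w)))) p)

double-<-half : ∀ {w m} → ⌊ w /2⌋ < m → w < 2 * m
double-<-half {w} {m} p = begin-strict
  w                              ≡⟨ double-half w ⟩
  bit (odd w) + 2 * ⌊ w /2⌋      <⟨ +-monoˡ-< (2 * ⌊ w /2⌋) (bit<2 (odd w)) ⟩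
  2 + 2 * ⌊ w /2⌋                ≡⟨ sym (*-suc 2 ⌊ w /2⌋) ⟩
  2 * suc ⌊ w /2⌋                ≤⟨ *-monoʳ-≤ 2 p ⟩
  2 * m                          ∎
  where
  open ≤-Reasoning
  bit<2 : ∀ b → bit b < 2
  bit<2 false = s≤s z≤n
  bit<2 true  = ≤-refl

digits-suc : ∀ w k → digits w (suc k) ≡ digits ⌊ w /2⌋ k
digits-suc w k = cong odd (sym (iterate-shift k w ⌊_/2⌋))

bits-digits-suc : ∀ w n → bits (digits w) (suc n) ≡ odd w ∷ bits (digits ⌊ w /2⌋) n
bits-digits-suc w n = trans (bits-suc (digits w) n) (cong (odd w ∷_) (bits-cong n (λ k _ → digits-suc w k)))

digits-surjective : ∀ s → ∃ λ w → w < 2 ^ length s × bits (digits w) (length s) ≡ s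
digits-surjective [] = 0 , ≤-refl , refl
digits-surjective (b ∷ s) with digits-surjective s
... | w , p , e = bit b + 2 * w , double-<-half (subst (_< _) (sym (half-double b w)) p) ,
  trans (bits-digits-suc _ (length s)) (cong₂ _∷_ (odd-double b w)
    (trans (cong (λ z → bits (digits z) (length s)) (half-double b w)) e))

digits-of : ∀ β n → ∃ λ w → w < 2 ^ n × (∀ k → k < n → digits w k ≡ β k)
digits-of β n with digits-surjective (bits β n)
... | w , p , e rewrite length-bits β n = w , p , bits-agree n e

digits-injective : ∀ n {v w} → v < 2 ^ n → w < 2 ^ n → bits (digits v) n ≡ bits (digits w) n → v ≡ w
digits-injective zero    p q e = trans (n<1⇒n≡0 p) (sym (n<1⇒n≡0 q))
digits-injective (suc n) {v} {w} p q e
  with ∷-injective (trans (sym (bits-digits-suc v n)) (trans e (bits-digits-suc w n)))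
... | a , b = trans (double-half v) (trans
  (cong₂ (λ b h → bit b + 2 * h) a (digits-injective n (half-< p) (half-< q) b)) (sym (double-half w)))

digits-high : ∀ n {w k} → k < n → digits (2 ^ n + w) k ≡ digits w k
digits-high (suc n) {w} {k} p = go k p
  where
  shape : 2 ^ suc n + w ≡ bit (odd w) + 2 * (2 ^ n + ⌊ w /2⌋)
  shape = trans (cong (2 ^ suc n +_) (double-half w))
    (solve 3 (λ a b h → con 2 :* a :+ (b :+ con 2 :* h) := b :+ con 2 :* (a :+ h)) refl (2 ^ n) (bit (odd w)) ⌊ w /2⌋)
  go : ∀ k → k < suc n → digits (2 ^ suc n + w) k ≡ digits w k
  go zero    p = trans (cong odd shape) (odd-double (odd w) (2 ^ n + ⌊ w /2⌋))
  go (suc k) p = trans (digits-suc (2 ^ suc n + w) k)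
    (trans (cong (λ z → digits z k) (trans (cong ⌊_/2⌋ shape) (half-double (odd w) (2 ^ n + ⌊ w /2⌋))))
      (trans (digits-high n (s≤s⁻¹ p)) (sym (digits-suc w k))))

-- Measures of cylinders and Kraft's inequality

Local : ℕ → (BitSeq → ℕ) → Set
Local n F = ∀ {β γ} → (∀ k → k < n → β k ≡ γ k) → F β ≡ F γ

-- The numbers below 2^(s+1) are w and 2^s + w for w < 2^s, and these two agree in the low s digits,
-- the only ones that `F` sees.
∑-double : ∀ {s F} → Local s F → ∑ (2 ^ suc s) (λ w → F (digits w)) ≡ 2 * ∑ (2 ^ s) (λ w → F (digits w))
∑-double {s} {F} loc = begin
  ∑ (2 ^ suc s) f                             ≡⟨ ∑-split (2 ^ s) (2 ^ s + 0) f ⟩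
  ∑ (2 ^ s) f + ∑ (2 ^ s + 0) (λ w → f (2 ^ s + w))
    ≡⟨ cong₂ (λ m g → ∑ (2 ^ s) f + ∑ m g) (+-identityʳ (2 ^ s)) refl ⟩
  ∑ (2 ^ s) f + ∑ (2 ^ s) (λ w → f (2 ^ s + w))
    ≡⟨ cong (∑ (2 ^ s) f +_) (∑-cong (2 ^ s) (λ w _ → loc (λ k p → digits-high s p))) ⟩
  ∑ (2 ^ s) f + ∑ (2 ^ s) f                   ≡⟨ cong (∑ (2 ^ s) f +_) (sym (+-identityʳ _)) ⟩
  2 * ∑ (2 ^ s) f                             ∎
  where
  open ≡-Reasoning
  f : ℕ → ℕ
  f w = F (digits w)

-- horner f s = Σ_{i≤s} 2^(s−i) f i: the total measure, in units of 2^(−s), of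
-- f i cylinders of length i for each i ≤ s.
horner : (ℕ → ℕ) → ℕ → ℕ
horner f zero    = f 0
horner f (suc s) = 2 * horner f s + f (suc s)

horner-mono : ∀ {f g} s → (∀ i → i ≤ s → f i ≤ g i) → horner f s ≤ horner g s
horner-mono zero    h = h 0 ≤-refl
horner-mono (suc s) h = +-mono-≤ (*-monoʳ-≤ 2 (horner-mono s (λ i p → h i (m≤n⇒m≤1+n p)))) (h (suc s) ≤-refl)

horner-*ˡ : ∀ c f s → horner (λ i → c * f i) s ≡ c * horner f s
horner-*ˡ c f zero    = refl
horner-*ˡ c f (suc s) rewrite horner-*ˡ c f s =
  solve 3 (λ c h x → con 2 :* (c :* h) :+ c :* x := c :* (con 2 :* h :+ x)) refl c (horner f s) (f (suc s))

-- A unit of `d i` occurs in the partial sums for n = i, ..., s, so it weighs 2^(s-i) + ... + 1 =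
-- 2·2^(s-i) - 1; the added sum supplies the missing 1.
horner-partial-sums : ∀ d s → horner (λ n → ∑ (suc n) d) s + ∑ (suc s) d ≡ 2 * horner d s
horner-partial-sums d zero    = cong (d 0 +_) (sym (+-identityʳ (d 0)))
horner-partial-sums d (suc s) = begin
  2 * h + (S + x) + (S + x)  ≡⟨ solve 3 (λ h S x → con 2 :* h :+ (S :+ x) :+ (S :+ x) := con 2 :* (h :+ S) :+ con 2 :* x) refl h S x ⟩
  2 * (h + S) + 2 * x        ≡⟨ cong (λ z → 2 * z + 2 * x) (horner-partial-sums d s) ⟩
  2 * (2 * horner d s) + 2 * x ≡⟨ sym (*-distribˡ-+ 2 (2 * horner d s) x) ⟩
  2 * (2 * horner d s + x)   ∎
  where
  open ≡-Reasoning
  h S x : ℕ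
  h = horner (λ n → ∑ (suc n) d) s
  S = ∑ (suc s) d
  x = d (suc s)

-- Every word of length i has 2^(s-i) extensions of length s, which is the weight that `horner`
-- gives to level i.
∑-horner : ∀ {F : ℕ → BitSeq → ℕ} → (∀ i → Local i (F i)) → ∀ s →
  ∑ (2 ^ s) (λ w → ∑ (suc s) (λ i → F i (digits w))) ≡ horner (λ i → ∑ (2 ^ i) (λ w → F i (digits w))) s
∑-horner loc zero = refl
∑-horner {F} loc (suc s) = trans (∑-+ (2 ^ suc s) _ _) (cong (_+ ∑ (2 ^ suc s) (λ w → F (suc s) (digits w))) (trans
  (∑-double {F = λ β → ∑ (suc s) (λ i → F i β)}
    (λ e → ∑-cong (suc s) (λ i p → loc i (λ k q → e k (<-≤-trans q (s≤s⁻¹ p))))))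
  (cong (2 *_) (∑-horner loc s))))

-- The value 0 of `o` matches nothing; any other value fixes at most one prefix of length `l` and
-- leaves `r` free bits.
cylinder : ∀ o l r → ∑ (2 ^ (l + r)) (λ w → [ o ≐ suc (encode (bits (digits w) l)) ]) ≤ 2 ^ r
cylinder o l zero rewrite +-identityʳ l = ∑-unique (2 ^ l) (λ w _ → ≐≤1 o _)
  λ v w p q a b → digits-injective l p q (encode-injective (suc-injective (trans (sym (≐⇒≡ o _ a)) (≐⇒≡ o _ b))))
cylinder o l (suc r) rewrite +-suc l r = ≤-trans (≤-reflexive
  (∑-double {F = λ β → [ o ≐ suc (encode (bits β l)) ]}
    (λ e → cong (λ z → [ o ≐ suc (encode z) ]) (bits-cong l (λ k p → e k (<-≤-trans p (m≤m+n l r)))))))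
  (*-monoʳ-≤ 2 (cylinder o l r))

module _ (h : ℕ → ℕ) (h≤1 : ∀ e → h e ≤ 1)
  (prefix-free : ∀ p q → 1 ≤ h (encode p) → 1 ≤ h (encode q) → p ≼ q → p ≡ q) where

  -- Each word of length s has at most one prefix accepted by `h`; summing this over all words gives
  -- the inequality in units of 2^(-s).
  kraft : ∀ s → horner (λ i → ∑ (2 ^ i) (λ u → h (encode (bits (digits u) i)))) s ≤ 2 ^ s
  kraft s = begin
    horner (λ i → ∑ (2 ^ i) (λ u → h (encode (bits (digits u) i)))) s
      ≡⟨ sym (∑-horner {λ i β → h (encode (bits β i))} (λ i e → cong (h ∘ encode) (bits-cong i e)) s) ⟩
    ∑ (2 ^ s) (λ w → ∑ (suc s) (λ i → h (encode (bits (digits w) i))))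
      ≤⟨ ∑-mono (2 ^ s) (λ w _ → ∑-unique (suc s) (λ i _ → h≤1 _) (λ i j _ _ → unique w i j)) ⟩
    ∑ (2 ^ s) (λ _ → 1)  ≡⟨ trans (∑-const (2 ^ s) 1) (*-identityʳ (2 ^ s)) ⟩
    2 ^ s                ∎
    where
    open ≤-Reasoning
    same-length : ∀ β i j → bits β i ≡ bits β j → i ≡ j
    same-length β i j e = trans (sym (length-bits β i)) (trans (cong length e) (length-bits β j))
    unique : ∀ w i j → 1 ≤ h (encode (bits (digits w) i)) → 1 ≤ h (encode (bits (digits w) j)) → i ≡ j
    unique w i j a b with ≤-total i j
    ... | inj₁ p = same-length (digits w) i j (prefix-free _ _ a b (bits-≼ (digits w) p))
    ... | inj₂ p = sym (same-length (digits w) j i (prefix-free _ _ b a (bits-≼ (digits w) p)))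

-- Dyadic intervals and codewords

bits-∷ʳ : ∀ β n → bits β (suc n) ≡ bits β n ++ β n ∷ []
bits-∷ʳ β zero    = refl
bits-∷ʳ β (suc n) = trans (bits-suc β (suc n)) (trans (cong (β 0 ∷_) (bits-∷ʳ (β ∘ suc) n))
  (cong (_++ β (suc n) ∷ []) (sym (bits-suc β n))))

-- The ℓ low-order binary digits of v, most significant first.
msb : ℕ → ℕ → Str
msb ℓ v = bits (λ i → digits v (ℓ ∸ suc i)) ℓ

msb-suc : ∀ ℓ v → msb (suc ℓ) v ≡ msb ℓ ⌊ v /2⌋ ++ odd v ∷ []
msb-suc ℓ v = trans (bits-∷ʳ _ ℓ) (cong₂ (λ s b → s ++ b ∷ [])
  (bits-cong ℓ (λ i p → trans (cong (digits v) (+-∸-assoc 1 p)) (digits-suc v (ℓ ∸ suc i))))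
  (cong (digits v) (n∸n≡0 ℓ)))

length-msb : ∀ ℓ v → length (msb ℓ v) ≡ ℓ
length-msb ℓ v = length-bits _ ℓ

msb-injective : ∀ ℓ {v w} → v < 2 ^ ℓ → w < 2 ^ ℓ → msb ℓ v ≡ msb ℓ w → v ≡ w
msb-injective zero    p q e = trans (n<1⇒n≡0 p) (sym (n<1⇒n≡0 q))
msb-injective (suc ℓ) {v} {w} p q e
  with ∷ʳ-injective (msb ℓ ⌊ v /2⌋) (msb ℓ ⌊ w /2⌋) (trans (sym (msb-suc ℓ v)) (trans e (msb-suc ℓ w)))
... | a , b = trans (double-half v) (trans
  (cong₂ (λ b h → bit b + 2 * h) b (msb-injective ℓ (half-< p) (half-< q) a)) (sym (double-half w)))

≼-∷ʳ : ∀ p q {b} → length p ≤ length q → p ≼ (q ++ b ∷ []) → p ≼ q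
≼-∷ʳ []      q       l       _       = q , refl
≼-∷ʳ (x ∷ p) (y ∷ q) (s≤s l) (r , e) with ∷-injective e
... | refl , e′ with ≼-∷ʳ p q l (r , e′)
... | r′ , e″ = r′ , cong (x ∷_) e″

-- In units of 2^(-ℓ) the space allotted at level ℓ is [0, A ℓ), and `grow` says that it never
-- shrinks. The dyadic interval of v lies inside it, so every longer extension w stays below twice
-- `A` of the preceding level, where the codes of its own level will begin.
msb-extension : ∀ {A : ℕ → ℕ} → (∀ ℓ → 2 * A ℓ ≤ A (suc ℓ)) → ∀ ℓ r {v w} →
  v < 2 ^ ℓ → w < 2 ^ (suc r + ℓ) → v < A ℓ → msb ℓ v ≼ msb (suc r + ℓ) w → w < 2 * A (r + ℓ)
msb-extension {A} grow ℓ r {v} {w} p q a m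
  with ≼-∷ʳ (msb ℓ v) (msb (r + ℓ) ⌊ w /2⌋)
         (subst₂ _≤_ (sym (length-msb ℓ v)) (sym (length-msb (r + ℓ) ⌊ w /2⌋)) (m≤n+m ℓ r))
         (subst (msb ℓ v ≼_) (msb-suc (r + ℓ) w) m)
msb-extension {A} grow ℓ zero {v} {w} p q a m | m′ =
  double-<-half (subst (_< A ℓ) (msb-injective ℓ p (half-< q)
    (≼-equal-length m′ (trans (length-msb ℓ v) (sym (length-msb ℓ ⌊ w /2⌋))))) a)
msb-extension {A} grow ℓ (suc r) p q a m | m′ =
  double-<-half (<-≤-trans (msb-extension {A} grow ℓ r p (half-< q) a m′) (grow (r + ℓ)))

header : ℕ → Str → Str
header zero    s = true ∷ s
header (suc k) s = false ∷ header k s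

length-header : ∀ k s → length (header k s) ≡ suc (k + length s)
length-header zero    s = refl
length-header (suc k) s = cong suc (length-header k s)

header-≼ : ∀ k k′ {s t} → header k s ≼ header k′ t → k ≡ k′ × s ≼ t
header-≼ zero    zero     (r , e) = refl , r , proj₂ (∷-injective e)
header-≼ zero    (suc k′) (r , ())
header-≼ (suc k) zero     (r , ())
header-≼ (suc k) (suc k′) (r , e) with header-≼ k k′ (r , proj₂ (∷-injective e))
... | refl , m = refl , m

digit-bitsᶜ : Computable₂ (λ w n → encode (bits (digits w) n))
digit-bitsᶜ = fun₂ (bitsᶜ (λ ρ → digits (lookup ρ 0F)) (λ _ _ → refl) v₁ (app₂ digitᶜ v₁ v₀))

msbᶜ : Computable₂ (λ ℓ v → encode (msb ℓ v))
msbᶜ = fun₂ (bitsᶜ (λ ρ i → digits (lookup ρ 1F) (lookup ρ 0F ∸ suc i)) (λ _ _ → refl) v₀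
  (app₂ digitᶜ v₂ (app₂ ∸ᶜ v₁ (sucᶜ v₀))))

encode-header : ∀ k s → encode (header k s) ≡ iterate k (2 + 2 * encode s) (λ e → suc (2 * e))
encode-header zero    s = refl
encode-header (suc k) s = cong (λ e → suc (2 * e)) (encode-header k s)

≱1⇒≡0 : ∀ {n} → ¬ (1 ≤ n) → n ≡ 0
≱1⇒≡0 p = n<1⇒n≡0 (≰⇒> p)

*-positiveˡ : ∀ {a b} → 1 ≤ a * b → 1 ≤ a
*-positiveˡ {suc a} p = s≤s z≤n

*-positiveʳ : ∀ {a b} → 1 ≤ a * b → 1 ≤ b
*-positiveʳ {a} {zero}  p = ⊥-elim (<⇒≢ p (sym (*-zeroʳ a)))
*-positiveʳ {a} {suc b} p = s≤s z≤n

⩽-mono : ∀ a {b c} → b ≤ c → [ a ⩽ b ] ≤ [ a ⩽ c ]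
⩽-mono zero    p       = ≤-refl
⩽-mono (suc a) z≤n     = z≤n
⩽-mono (suc a) (s≤s p) = ⩽-mono a p

*-⩽-bound : ∀ a → 1 ≤ a → ∀ b → a * [ a ⩽ b ] ≤ b
*-⩽-bound a p b with [ a ⩽ b ] in e
... | zero = subst (_≤ b) (sym (*-zeroʳ a)) z≤n
... | suc k = ≤-trans (≤-trans (*-monoʳ-≤ a (subst (_≤ 1) e (⩽≤1 a b))) (≤-reflexive (*-identityʳ a)))
  (⩽⇒≤ a b (subst (1 ≤_) (sym e) (s≤s z≤n)))

-- The Solovay test and the decoder

module Construction (V M : Program) (V-computer : IsComputer V) (b : ℕ) where

  halted : ℕ → ℕ → ℕ
  halted e t = halts V no-oracle e t

  χ : ℕ → ℕ → ℕ → ℕ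
  -- The first factor tests that the string coded by `v` has length at most `n`.
  χ n t v = [ 2 + v ⩽ 2 ^ suc n ] * halted v t

  -- The halting time of e, provided that it is at most s.
  opaque
    time : ℕ → ℕ → ℕ
    time e s = ∑ s (λ t → 1 ∸ halted e t)

  -- 1 + the output of M on n for the oracle given by the halting time of e, and
  -- 0 if one of the two computations takes more than s steps.
  out : ℕ → ℕ → ℕ → ℕ
  out s n e = halted e s * (halts M (χ n (time e s)) n s * suc (result M (χ n (time e s)) n s))

  -- u ranges over the strings of length i in Dom V, and j over the possible f n.
  match : ℕ → ℕ → BitSeq → ℕ → ℕ → ℕ → ℕ
  match s n β i u j = [ out s n (encode (bits (digits u) i)) ≐ suc (encode (bits β (n ∸ j))) ]

  cand : ℕ → ℕ → BitSeq → ℕ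
  cand s n β = ∑ (suc n) λ i → ∑ (2 ^ i) λ u → ∑ (suc b) λ j → match s n β i u j

  -- The stage-s approximation to the number of cylinders of the test that contain β, with
  -- multiplicity. Only levels n ≤ s enter, so that it depends on s bits of β.
  count : ℕ → BitSeq → ℕ
  count s β = ∑ (suc s) λ n → cand s n β

  opaque
    K : ℕ
    -- There are b + 1 values of j; cutting at n - j instead of n enlarges a cylinder by at most
    -- 2^b; and the sum of 2^(-n) over n ≥ |p| is 2·2^(-|p|).
    K = suc b * 2 ^ b * 2

    K≡ : K ≡ suc b * 2 ^ b * 2
    K≡ = refl

  threshold : ℕ → ℕ
  threshold k = K * 2 ^ (k + k)

  big : ℕ → ℕ → BitSeq → ℕ
  big k s β = [ threshold k ⩽ count s β ]

  previous : ℕ → ℕ → BitSeq → ℕ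
  previous k zero    β = 0
  previous k (suc s) β = big k s β

  -- Since count s β increases with s, this is 1 at the first stage where β is
  -- big, and 0 at all others.
  new : ℕ → ℕ → BitSeq → ℕ
  new k s β = big k s β ∸ previous k s β

  news : ℕ → ℕ → ℕ
  news k s = ∑ (2 ^ s) (λ w → new k s (digits w))

  opaque
    total : ℕ → ℕ → ℕ
    total k s = horner (news k) s

  -- The codes base k s, …, total k s − 1 belong to the strings new at stage s;
  -- total k s · 2^(−s) is the measure of all strings found by then.
  base : ℕ → ℕ → ℕ
  base k zero    = 0
  base k (suc s) = 2 * total k s

  opaque
    index : ℕ → ℕ → ℕ → ℕ
    index k s w = base k s + ∑ w (λ w′ → new k s (digits w′))

  -- Using the codeword length ℓ as the parameter, rather than the stage, avoids a truncated
  -- subtraction of 2k.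
  stage : ℕ → ℕ → ℕ
  stage k ℓ = ℓ + (k + k)

  codeword : ℕ → ℕ → ℕ → Str
  codeword k ℓ w = header k (msb ℓ (index k (stage k ℓ) w))

  -- 0 off the codewords; at most one term of the sum is nonzero.
  opaque
    decoder : ℕ → ℕ
    -- The bounds lose nothing: k and ℓ are smaller than the length of the codeword, which is at
    -- most its code `x`. This keeps the decoder total.
    decoder x = ∑ (suc x) λ k → ∑ (suc x) λ ℓ → ∑ (2 ^ stage k ℓ) λ w →
      new k (stage k ℓ) (digits w) * ([ x ≐ encode (codeword k ℓ w) ] * suc (encode (bits (digits w) (stage k ℓ))))

  -- Computability of the decoder

  haltedᶜ : Computable₂ halted
  haltedᶜ = fun₂ (app₄ (haltsᶜ {λ _ _ _ → 0} (fun₃ zeroᶜ) V) zeroᶜ zeroᶜ v₀ v₁)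

  χᶜ : Computable₃ χ
  χᶜ = fun₃ (app₂ *ᶜ (app₂ ⩽ᶜ (sucᶜ (sucᶜ v₂)) (app₂ ^ᶜ (constᶜ 2) (sucᶜ v₀))) (app₂ haltedᶜ v₂ v₁))

  opaque
    unfolding time

    timeᶜ : Computable₂ time
    timeᶜ = fun₂ (∑ᶜ v₁ (app₂ ∸ᶜ (constᶜ 1) (app₂ haltedᶜ v₁ v₀)))

  outᶜ : Computable₃ out
  outᶜ = fun₃ (app₂ *ᶜ (app₂ haltedᶜ v₂ v₀) (app₂ *ᶜ
    (app₄ (haltsᶜ χᶜ M) v₁ (app₂ timeᶜ v₂ v₀) v₁ v₀)
    (sucᶜ (app₄ (resultᶜ χᶜ M) v₁ (app₂ timeᶜ v₂ v₀) v₁ v₀))))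

  candᶜ : Computable₃ (λ s n w → cand s n (digits w))
  candᶜ = fun₃ (∑ᶜ (sucᶜ v₁) (∑ᶜ (app₂ ^ᶜ (constᶜ 2) v₀) (∑ᶜ (constᶜ (suc b))
    (app₂ ≐ᶜ (app₃ outᶜ v₃ v₄ (app₂ digit-bitsᶜ v₁ v₂))
      (sucᶜ (app₂ digit-bitsᶜ v₅ (app₂ ∸ᶜ v₄ v₀)))))))

  bigᶜ : Computable₃ (λ k s w → big k s (digits w))
  bigᶜ = fun₃ (app₂ ⩽ᶜ (app₂ *ᶜ (constᶜ K) (app₂ ^ᶜ (constᶜ 2) (app₂ +ᶜ v₀ v₀)))
    (∑ᶜ (sucᶜ v₁) (app₃ candᶜ v₂ v₀ v₃)))

  previousᶜ : Computable₃ (λ k s w → previous k s (digits w))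
  previousᶜ = fun₃ (ext (λ ρ → go (lookup ρ 0F) (lookup ρ 1F) (lookup ρ 2F))
    (app₃ condᶜ v₁ (app₃ bigᶜ v₀ (predᶜ v₁) v₂) zeroᶜ))
    where
    go : ∀ k s w → cond s (big k (pred s) (digits w)) 0 ≡ previous k s (digits w)
    go k zero    w = refl
    go k (suc s) w = refl

  newᶜ : Computable₃ (λ k s w → new k s (digits w))
  newᶜ = fun₃ (app₂ ∸ᶜ (app₃ bigᶜ v₀ v₁ v₂) (app₃ previousᶜ v₀ v₁ v₂))

  newsᶜ : Computable₂ news
  newsᶜ = fun₂ (∑ᶜ (app₂ ^ᶜ (constᶜ 2) v₁) (app₃ newᶜ v₁ v₂ v₀))

  opaque
    unfolding total

    totalᶜ : Computable₂ total
    totalᶜ = fun₂ (ext (λ ρ → rec≡ (total (lookup ρ 0F)) refl (λ _ → refl) (lookup ρ 1F))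
      (recᶜ v₁ (app₂ newsᶜ v₀ zeroᶜ)
        (app₂ +ᶜ (app₂ *ᶜ (constᶜ 2) v₀) (app₂ newsᶜ v₂ (sucᶜ v₁)))))

  baseᶜ : Computable₂ base
  baseᶜ = fun₂ (ext (λ ρ → go (lookup ρ 0F) (lookup ρ 1F))
    (app₃ condᶜ v₁ (app₂ *ᶜ (constᶜ 2) (app₂ totalᶜ v₀ (predᶜ v₁))) zeroᶜ))
    where
    go : ∀ k s → cond s (2 * total k (pred s)) 0 ≡ base k s
    go k zero    = refl
    go k (suc s) = refl

  opaque
    unfolding index

    indexᶜ : Computable₃ index
    indexᶜ = fun₃ (app₂ +ᶜ (app₂ baseᶜ v₀ v₁) (∑ᶜ v₂ (app₃ newᶜ v₁ v₂ v₀)))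

  stageᶜ : Computable₂ stage
  stageᶜ = fun₂ (app₂ +ᶜ v₁ (app₂ +ᶜ v₀ v₀))

  codewordᶜ : Computable₃ (λ k ℓ w → encode (codeword k ℓ w))
  codewordᶜ = fun₃ (ext (λ ρ → trans
      (rec≡ {s = λ _ e → suc (2 * e)} (λ k → iterate k (2 + 2 * code′ ρ) (λ e → suc (2 * e))) refl (λ _ → refl) (lookup ρ 0F))
      (sym (encode-header (lookup ρ 0F) _)))
    (recᶜ v₀ (sucᶜ (sucᶜ (app₂ *ᶜ (constᶜ 2)
        (app₂ msbᶜ v₁ (app₃ indexᶜ v₀ (app₂ stageᶜ v₀ v₁) v₂)))))
      (sucᶜ (app₂ *ᶜ (constᶜ 2) v₀))))
    where
    code′ : Vec ℕ 3 → ℕ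
    code′ ρ = encode (msb (lookup ρ 1F) (index (lookup ρ 0F) (stage (lookup ρ 0F) (lookup ρ 1F)) (lookup ρ 2F)))

  opaque
    unfolding decoder

    decoderᶜ : Computable₁ decoder
    decoderᶜ = fun₁ (∑ᶜ (sucᶜ v₀) (∑ᶜ (sucᶜ v₁) (∑ᶜ (app₂ ^ᶜ (constᶜ 2) (app₂ stageᶜ v₁ v₀))
      (app₂ *ᶜ (app₃ newᶜ v₂ (app₂ stageᶜ v₂ v₁) v₀)
        (app₂ *ᶜ (app₂ ≐ᶜ v₃ (app₃ codewordᶜ v₂ v₁ v₀))
          (sucᶜ (app₂ digit-bitsᶜ v₀ (app₂ stageᶜ v₂ v₁))))))))

  halted≤1 : ∀ e t → halted e t ≤ 1
  halted≤1 e t = halts≤1 V no-oracle e t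

  halted⇒Dom : ∀ {p t} → 1 ≤ halted (encode p) t → Dom V p
  halted⇒Dom {p} {t} h with halts⇒Runs {V} {encode p} {t} (≤-antisym (halted≤1 (encode p) t) h)
  ... | y , r with encode-surjective y
  ... | s , refl = s , r

  -- Locality

  match-local : ∀ s n i u j → Local n (λ β → match s n β i u j)
  match-local s n i u j e = cong (λ z → [ out s n (encode (bits (digits u) i)) ≐ suc (encode z) ])
    (bits-cong (n ∸ j) (λ k p → e k (<-≤-trans p (m∸n≤m n j))))

  cand-local : ∀ s n → Local n (cand s n)
  cand-local s n e = ∑-cong (suc n) λ i _ → ∑-cong (2 ^ i) λ u _ → ∑-cong (suc b) λ j _ → match-local s n i u j e

  count-local : ∀ s → Local s (count s)
  count-local s e = ∑-cong (suc s) λ n p → cand-local s n (λ k q → e k (<-≤-trans q (s≤s⁻¹ p)))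

  previous-local : ∀ k s → Local s (previous k s)
  previous-local k zero    e = refl
  previous-local k (suc s) e = cong [ threshold k ⩽_] (count-local s (λ i p → e i (m≤n⇒m≤1+n p)))

  new-local : ∀ k s → Local s (new k s)
  new-local k s e = cong₂ _∸_ (cong [ threshold k ⩽_] (count-local s e)) (previous-local k s e)

  -- Monotonicity in the stage

  opaque
    unfolding time

    time-stable : ∀ {e s s′} → 1 ≤ halted e s → s ≤ s′ → time e s′ ≡ time e s
    time-stable {e} {s} {s′} h p = subst (λ z → time e z ≡ time e s) (m+[n∸m]≡n p)
      (trans (∑-split s (s′ ∸ s) _) (trans (cong (time e s +_) (∑-zero (s′ ∸ s)
        (λ t _ → cong (1 ∸_) (halts-stable (≤-antisym (halted≤1 e s) h) (m≤m+n s t))))) (+-identityʳ _)))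

  out-intro : ∀ {s n e y} → halted e s ≡ 1 → halts M (χ n (time e s)) n s ≡ 1 →
    result M (χ n (time e s)) n s ≡ y → out s n e ≡ suc y
  out-intro {s} {n} {e} {y} h h′ r = trans (cong₂ _*_ h (cong₂ (λ a c → a * suc c) h′ r))
    (trans (*-identityˡ (1 * suc y)) (*-identityˡ (suc y)))

  -- The oracle depends on s only through `time e s`, which is frozen once e has halted; the factor
  -- `halted e s` in `out` excludes the values before that.
  out-stable : ∀ {s s′ n e} → s ≤ s′ → 1 ≤ out s n e → out s′ n e ≡ out s n e
  out-stable {s} {s′} {n} {e} p h = trans
    (out-intro (halts-stable h₁ p)
      (trans (cong (λ t → halts M (χ n t) n s′) stable) (halts-stable h₂ p))
      (trans (cong (λ t → result M (χ n t) n s′) stable) (result-stable h₂ p)))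
    (sym (out-intro h₁ h₂ refl))
    where
    h₁ : halted e s ≡ 1
    h₁ = ≤-antisym (halted≤1 e s) (*-positiveˡ h)
    h₂ : halts M (χ n (time e s)) n s ≡ 1
    h₂ = ≤-antisym (halts≤1 M _ n s) (*-positiveˡ (*-positiveʳ {halted e s} h))
    stable : time e s′ ≡ time e s
    stable = time-stable (*-positiveˡ h) p

  ≐-out-mono : ∀ {s s′ n e y} → s ≤ s′ → [ out s n e ≐ suc y ] ≤ [ out s′ n e ≐ suc y ]
  ≐-out-mono {s} {s′} {n} {e} {y} p with out s n e in q
  ... | zero  = z≤n
  ... | suc x = ≤-reflexive (cong [_≐ suc y ]
    (sym (trans (out-stable p (subst (1 ≤_) (sym q) (s≤s z≤n))) q)))

  cand-mono : ∀ {s s′} n β → s ≤ s′ → cand s n β ≤ cand s′ n β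
  cand-mono n β p = ∑-mono (suc n) λ i _ → ∑-mono (2 ^ i) λ u _ → ∑-mono (suc b) λ j _ → ≐-out-mono p

  count-mono : ∀ {s s′} β → s ≤ s′ → count s β ≤ count s′ β
  count-mono {s} {s′} β p = ≤-trans (∑-mono (suc s) (λ n _ → cand-mono n β p)) (∑-extend _ (s≤s p))

  big-telescopes : ∀ k s β → ∑ (suc s) (λ i → new k i β) ≡ big k s β
  big-telescopes k zero    β = refl
  big-telescopes k (suc s) β = trans (cong (_+ new k (suc s) β) (big-telescopes k s β))
    (m+[n∸m]≡n (⩽-mono (threshold k) (count-mono β (n≤1+n s))))

  new≤1 : ∀ k s β → new k s β ≤ 1
  new≤1 k s β = ≤-trans (m∸n≤m (big k s β) (previous k s β)) (⩽≤1 (threshold k) _)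

  -- Weights

  halting : ℕ → ℕ → ℕ
  halting s i = ∑ (2 ^ i) (λ u → halted (encode (bits (digits u) i)) s)

  -- A program that has not halted has `out` equal to 0 and matches nothing. Otherwise all matching
  -- words of length n share their first n ∸ j bits, so at most j ≤ b bits are free.
  match-weight : ∀ s n i u j → j < suc b →
    ∑ (2 ^ n) (λ v → match s n (digits v) i u j) ≤ 2 ^ b * halted (encode (bits (digits u) i)) s
  match-weight s n i u j p with 1 ≤? halted (encode (bits (digits u) i)) s
  ... | no h = ≤-trans (≤-reflexive (∑-zero (2 ^ n) λ v _ → vanish v)) z≤n
    where
    vanish : ∀ v → match s n (digits v) i u j ≡ 0
    vanish v with 1 ≤? match s n (digits v) i u j
    ... | no q  = ≱1⇒≡0 q
    ... | yes q = ⊥-elim (h (*-positiveˡ (subst (1 ≤_) (sym (≐⇒≡ _ _ q)) (s≤s z≤n))))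
  ... | yes h = begin
    ∑ (2 ^ n) (λ v → match s n (digits v) i u j)
      ≡⟨ cong (λ m → ∑ (2 ^ m) (λ v → match s n (digits v) i u j)) (sym (m+[n∸m]≡n (m∸n≤m n j))) ⟩
    ∑ (2 ^ (n ∸ j + (n ∸ (n ∸ j)))) (λ v → match s n (digits v) i u j)
      ≤⟨ cylinder (out s n (encode (bits (digits u) i))) (n ∸ j) (n ∸ (n ∸ j)) ⟩
    2 ^ (n ∸ (n ∸ j))
      ≤⟨ ^-monoʳ-≤ 2 (≤-trans (m≤n+o⇒m∸n≤o n (n ∸ j) (≤-trans (m≤n+m∸n n j) (≤-reflexive (+-comm j (n ∸ j))))) (s≤s⁻¹ p)) ⟩
    2 ^ b  ≤⟨ m≤m*n (2 ^ b) _ {{>-nonZero h}} ⟩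
    2 ^ b * halted (encode (bits (digits u) i)) s  ∎
    where open ≤-Reasoning

  cand-weight : ∀ s n → ∑ (2 ^ n) (λ v → cand s n (digits v)) ≤ suc b * 2 ^ b * ∑ (suc n) (halting s)
  cand-weight s n = begin
    ∑ (2 ^ n) (λ v → ∑ (suc n) λ i → ∑ (2 ^ i) λ u → ∑ (suc b) λ j → match s n (digits v) i u j)
      ≡⟨ ∑-swap (2 ^ n) (suc n) _ ⟩
    ∑ (suc n) (λ i → ∑ (2 ^ n) λ v → ∑ (2 ^ i) λ u → ∑ (suc b) λ j → match s n (digits v) i u j)
      ≤⟨ ∑-mono (suc n) (λ i _ → level i) ⟩
    ∑ (suc n) (λ i → suc b * 2 ^ b * halting s i)
      ≡⟨ ∑-*ˡ (suc n) (suc b * 2 ^ b) (halting s) ⟩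
    suc b * 2 ^ b * ∑ (suc n) (halting s)  ∎
    where
    open ≤-Reasoning
    level : ∀ i → ∑ (2 ^ n) (λ v → ∑ (2 ^ i) λ u → ∑ (suc b) λ j → match s n (digits v) i u j)
      ≤ suc b * 2 ^ b * halting s i
    level i = begin
      ∑ (2 ^ n) (λ v → ∑ (2 ^ i) λ u → ∑ (suc b) λ j → match s n (digits v) i u j)
        ≡⟨ ∑-swap (2 ^ n) (2 ^ i) _ ⟩
      ∑ (2 ^ i) (λ u → ∑ (2 ^ n) λ v → ∑ (suc b) λ j → match s n (digits v) i u j)
        ≡⟨ ∑-cong (2 ^ i) (λ u _ → ∑-swap (2 ^ n) (suc b) _) ⟩
      ∑ (2 ^ i) (λ u → ∑ (suc b) λ j → ∑ (2 ^ n) λ v → match s n (digits v) i u j)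
        ≤⟨ ∑-mono (2 ^ i) (λ u _ → ∑-mono (suc b) (λ j p → match-weight s n i u j p)) ⟩
      ∑ (2 ^ i) (λ u → ∑ (suc b) λ j → 2 ^ b * halted (encode (bits (digits u) i)) s)
        ≡⟨ ∑-cong (2 ^ i) (λ u _ → trans (∑-const (suc b) _) (sym (*-assoc (suc b) (2 ^ b) _))) ⟩
      ∑ (2 ^ i) (λ u → suc b * 2 ^ b * halted (encode (bits (digits u) i)) s)
        ≡⟨ ∑-*ˡ (2 ^ i) (suc b * 2 ^ b) _ ⟩
      suc b * 2 ^ b * halting s i  ∎

  count-weight : ∀ s → ∑ (2 ^ s) (λ w → count s (digits w)) ≤ K * 2 ^ s
  count-weight s = begin
    ∑ (2 ^ s) (λ w → ∑ (suc s) λ n → cand s n (digits w))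
      ≡⟨ ∑-horner {cand s} (cand-local s) s ⟩
    horner (λ n → ∑ (2 ^ n) (λ v → cand s n (digits v))) s
      ≤⟨ horner-mono s (λ n _ → cand-weight s n) ⟩
    horner (λ n → suc b * 2 ^ b * ∑ (suc n) (halting s)) s
      ≡⟨ horner-*ˡ (suc b * 2 ^ b) (λ n → ∑ (suc n) (halting s)) s ⟩
    suc b * 2 ^ b * horner (λ n → ∑ (suc n) (halting s)) s
      ≤⟨ *-monoʳ-≤ (suc b * 2 ^ b) (≤-trans (m≤m+n _ (∑ (suc s) (halting s)))
           (≤-reflexive (horner-partial-sums (halting s) s))) ⟩
    suc b * 2 ^ b * (2 * horner (halting s) s)
      -- The programs seen to halt by stage s belong to the prefix-free `Dom V`, so Kraft's
      -- inequality applies at every finite stage.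
      ≤⟨ *-monoʳ-≤ (suc b * 2 ^ b) (*-monoʳ-≤ 2 (kraft (λ e → halted e s) (λ e → halted≤1 e s)
           (λ p q g h → V-computer p q (halted⇒Dom g) (halted⇒Dom h)) s)) ⟩
    suc b * 2 ^ b * (2 * 2 ^ s)
      ≡⟨ trans (sym (*-assoc (suc b * 2 ^ b) 2 (2 ^ s))) (cong (_* 2 ^ s) (sym K≡)) ⟩
    K * 2 ^ s  ∎
    where open ≤-Reasoning

  K>0 : 1 ≤ K
  K>0 = subst (1 ≤_) (sym K≡) (*-mono-≤ {1} {suc b * 2 ^ b} {1} {2} (*-mono-≤ {1} {suc b} {1} (s≤s z≤n) (m^n>0 2 b)) (s≤s z≤n))

  threshold>0 : ∀ k → 1 ≤ threshold k
  threshold>0 k = *-mono-≤ {1} {_} {1} K>0 (m^n>0 2 (k + k))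

  opaque
    unfolding total

    -- Markov's inequality: `count` has mean at most `K`, while big words reach `K` times 4^k.
    -- Telescoping identifies the words below some new word with those big at stage s.
    total-bound : ∀ k s → 2 ^ (k + k) * total k s ≤ 2 ^ s
    total-bound k s = *-cancelˡ-≤ K {{>-nonZero K>0}} (begin
      K * (2 ^ (k + k) * total k s)         ≡⟨ sym (*-assoc K _ _) ⟩
      threshold k * total k s
        ≡⟨ cong (threshold k *_) (sym (∑-horner {new k} (new-local k) s)) ⟩
      threshold k * ∑ (2 ^ s) (λ w → ∑ (suc s) λ i → new k i (digits w))
        ≡⟨ cong (threshold k *_) (∑-cong (2 ^ s) (λ w _ → big-telescopes k s (digits w))) ⟩
      threshold k * ∑ (2 ^ s) (λ w → big k s (digits w))
        ≡⟨ sym (∑-*ˡ (2 ^ s) (threshold k) _) ⟩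
      ∑ (2 ^ s) (λ w → threshold k * big k s (digits w))
        ≤⟨ ∑-mono (2 ^ s) (λ w _ → *-⩽-bound (threshold k) (threshold>0 k) (count s (digits w))) ⟩
      ∑ (2 ^ s) (λ w → count s (digits w))  ≤⟨ count-weight s ⟩
      K * 2 ^ s                             ∎)
      where open ≤-Reasoning

  total-small : ∀ k ℓ → total k (stage k ℓ) ≤ 2 ^ ℓ
  total-small k ℓ = *-cancelˡ-≤ (2 ^ (k + k)) {{>-nonZero (m^n>0 2 (k + k))}} (begin
    2 ^ (k + k) * total k (stage k ℓ)  ≤⟨ total-bound k (stage k ℓ) ⟩
    2 ^ (ℓ + (k + k))                  ≡⟨ cong (2 ^_) (+-comm ℓ (k + k)) ⟩
    2 ^ (k + k + ℓ)                    ≡⟨ ^-distribˡ-+-* 2 (k + k) ℓ ⟩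
    2 ^ (k + k) * 2 ^ ℓ                ∎)
    where open ≤-Reasoning

  -- Codewords

  record Valid (k s w : ℕ) : Set where
    constructor valid
    field
      in-range : w < 2 ^ s
      is-new   : 1 ≤ new k s (digits w)
  open Valid

  opaque
    unfolding total

    total-base : ∀ k s → total k s ≡ base k s + news k s
    total-base k zero    = refl
    total-base k (suc s) = refl

  total-grows : ∀ k s → 2 * total k s ≤ total k (suc s)
  total-grows k s = ≤-trans (m≤m+n _ (news k (suc s))) (≤-reflexive (sym (total-base k (suc s))))

  opaque
    unfolding index

    base≤index : ∀ k s w → base k s ≤ index k s w
    base≤index k s w = m≤m+n _ _

    index-< : ∀ {k s w} → Valid k s w → index k s w < total k s
    index-< {k} {s} {w} g = begin-strict
      base k s + ∑ w f       <⟨ +-monoʳ-< (base k s) (≤-trans (≤-reflexive (+-comm 1 _)) (+-monoʳ-≤ (∑ w f) (is-new g))) ⟩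
      base k s + ∑ (suc w) f ≤⟨ +-monoʳ-≤ (base k s) (∑-extend f (in-range g)) ⟩
      base k s + news k s    ≡⟨ sym (total-base k s) ⟩
      total k s              ∎
      where
      open ≤-Reasoning
      f : ℕ → ℕ
      f w = new k s (digits w)

    index-mono : ∀ {k s v w} → Valid k s v → v < w → index k s v < index k s w
    index-mono {k} {s} {v} {w} g p = +-monoʳ-< (base k s)
      (≤-trans (≤-trans (≤-reflexive (+-comm 1 _)) (+-monoʳ-≤ (∑ v f) (is-new g))) (∑-extend f p))
      where
      f : ℕ → ℕ
      f w = new k s (digits w)

  index-injective : ∀ {k s v w} → Valid k s v → Valid k s w → index k s v ≡ index k s w → v ≡ w
  index-injective {v = v} {w} g h e with <-cmp v w
  ... | tri< p _ _ = ⊥-elim (<⇒≢ (index-mono g p) e)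
  ... | tri≈ _ p _ = p
  ... | tri> _ _ p = ⊥-elim (<⇒≢ (index-mono h p) (sym e))

  index<2^ : ∀ {k ℓ w} → Valid k (stage k ℓ) w → index k (stage k ℓ) w < 2 ^ ℓ
  index<2^ {k} {ℓ} g = <-≤-trans (index-< g) (total-small k ℓ)

  -- The header determines k. At equal lengths the indices coincide, and they are injective. At
  -- different lengths `msb-extension` puts the longer index below `base` of its stage, whereas
  -- every index there is at least `base`.
  codeword-prefix : ∀ {k ℓ w k′ ℓ′ w′} → Valid k (stage k ℓ) w → Valid k′ (stage k′ ℓ′) w′ →
    codeword k ℓ w ≼ codeword k′ ℓ′ w′ → k ≡ k′ × ℓ ≡ ℓ′ × w ≡ w′
  codeword-prefix {k} {ℓ} {w} {k′} {ℓ′} {w′} g h m with header-≼ k k′ m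
  ... | refl , m′ with m≤n⇒m<n∨m≡n (subst₂ _≤_ (length-msb ℓ _) (length-msb ℓ′ _) (≼-length m′))
  ... | inj₂ refl = refl , refl , index-injective g h (msb-injective ℓ (index<2^ {k} {ℓ} g) (index<2^ {k} {ℓ} h)
          (≼-equal-length m′ (trans (length-msb ℓ _) (sym (length-msb ℓ _)))))
  ... | inj₁ q = ⊥-elim (longer (ℓ′ ∸ suc ℓ) (trans (sym (m∸n+n≡m q)) (+-suc (ℓ′ ∸ suc ℓ) ℓ)) h m′)
    where
    longer : ∀ r {ℓ′ w′} → ℓ′ ≡ suc r + ℓ → Valid k (stage k ℓ′) w′ →
      ¬ (msb ℓ (index k (stage k ℓ) w) ≼ msb ℓ′ (index k (stage k ℓ′) w′))
    longer r {w′ = w′} refl h m = <⇒≱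
      (msb-extension {λ ℓ → total k (stage k ℓ)} (λ ℓ → total-grows k (stage k ℓ)) ℓ r
        (index<2^ {k} {ℓ} g) (index<2^ {k} {suc r + ℓ} h) (index-< g) m)
      (base≤index k (stage k (suc r + ℓ)) w′)

  opaque
    unfolding decoder

    decoder-sound : ∀ {x y} → decoder x ≡ suc y →
      ∃ λ k → ∃ λ ℓ → ∃ λ w → Valid k (stage k ℓ) w × x ≡ encode (codeword k ℓ w)
    decoder-sound {x} e with ∑-positive (suc x) (subst (1 ≤_) (sym e) (s≤s z≤n))
    ... | k , _ , p with ∑-positive (suc x) p
    ... | ℓ , _ , q with ∑-positive (2 ^ stage k ℓ) q
    ... | w , r , t = k , ℓ , w , valid r (*-positiveˡ t) ,
      ≐⇒≡ x _ (*-positiveˡ {[ x ≐ encode (codeword k ℓ w) ]} (*-positiveʳ {new k (stage k ℓ) (digits w)} t))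

    decoder-complete : ∀ {k ℓ w} → Valid k (stage k ℓ) w →
      decoder (encode (codeword k ℓ w)) ≡ suc (encode (bits (digits w) (stage k ℓ)))
    decoder-complete {k} {ℓ} {w} g = begin
      decoder x
        ≡⟨ ∑-single (suc x) k<x (λ k′ _ ne → ∑-zero (suc x) λ ℓ′ _ → ∑-zero (2 ^ stage k′ ℓ′)
             λ w′ p → vanish k′ ℓ′ w′ p (ne ∘ proj₁)) ⟩
      ∑ (suc x) (λ ℓ → ∑ (2 ^ stage k ℓ) (λ w → term k ℓ w))
        ≡⟨ ∑-single (suc x) ℓ<x (λ ℓ′ _ ne → ∑-zero (2 ^ stage k ℓ′)
             λ w′ p → vanish k ℓ′ w′ p (ne ∘ proj₁ ∘ proj₂)) ⟩
      ∑ (2 ^ stage k ℓ) (λ w → term k ℓ w)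
        ≡⟨ ∑-single (2 ^ stage k ℓ) (in-range g) (λ w′ p ne → vanish k ℓ w′ p (ne ∘ proj₂ ∘ proj₂)) ⟩
      term k ℓ w
        ≡⟨ cong₂ (λ a c → a * (c * y)) (≤-antisym (new≤1 k (stage k ℓ) (digits w)) (is-new g)) (≐-refl x) ⟩
      1 * (1 * y)  ≡⟨ trans (*-identityˡ (1 * y)) (*-identityˡ y) ⟩
      y            ∎
      where
      open ≡-Reasoning
      x y : ℕ
      x = encode (codeword k ℓ w)
      y = suc (encode (bits (digits w) (stage k ℓ)))
      term : ℕ → ℕ → ℕ → ℕ
      term k ℓ w =
        new k (stage k ℓ) (digits w) * ([ x ≐ encode (codeword k ℓ w) ] * suc (encode (bits (digits w) (stage k ℓ))))
      size-x : k + ℓ < suc x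
      size-x = s≤s (≤-trans (n≤1+n (k + ℓ)) (≤-trans (≤-reflexive (sym (trans (length-header k _) (cong (λ z → suc (k + z)) (length-msb ℓ _)))))
        (length≤encode (codeword k ℓ w))))
      k<x : k < suc x
      k<x = ≤-<-trans (m≤m+n k ℓ) size-x
      ℓ<x : ℓ < suc x
      ℓ<x = ≤-<-trans (m≤n+m ℓ k) size-x
      vanish : ∀ k′ ℓ′ w′ → w′ < 2 ^ stage k′ ℓ′ → ¬ (k′ ≡ k × ℓ′ ≡ ℓ × w′ ≡ w) → term k′ ℓ′ w′ ≡ 0
      vanish k′ ℓ′ w′ p ne with 1 ≤? term k′ ℓ′ w′
      ... | no q  = ≱1⇒≡0 q
      ... | yes q = ⊥-elim (ne (codeword-prefix (valid p (*-positiveˡ q)) g ([] , trans (++-identityʳ _)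
        (sym (encode-injective (≐⇒≡ x _ (*-positiveˡ {[ x ≐ encode (codeword k′ ℓ′ w′) ]}
          (*-positiveʳ {new k′ (stage k′ ℓ′) (digits w′)} q))))))))

  opaque
    machine-exists : ∃ λ C → (∀ {x y} → decoder x ≡ suc y → Runs ∅ C x y) ×
      (∀ {x y} → Runs ∅ C x y → decoder x ≡ suc y)
    machine-exists = machine , machine-sound , machine-complete
      where open Machine {decoder} (Computable₁.body₁ decoderᶜ)

  machine : Program
  machine = proj₁ machine-exists

  machine-sound : ∀ {x y} → decoder x ≡ suc y → Runs ∅ machine x y
  machine-sound = proj₁ (proj₂ machine-exists)

  machine-complete : ∀ {x y} → Runs ∅ machine x y → decoder x ≡ suc y
  machine-complete = proj₂ (proj₂ machine-exists)

  machine-computer : IsComputer machine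
  machine-computer p q (s , g) (t , h) m
    with decoder-sound (machine-complete g) | decoder-sound (machine-complete h)
  ... | k , ℓ , w , v , e | k′ , ℓ′ , w′ , v′ , e′
    with encode-injective {p} {codeword k ℓ w} e | encode-injective {q} {codeword k′ ℓ′ w′} e′
  ... | refl | refl with codeword-prefix v v′ m
  ... | refl , refl , refl = refl

  -- The last program to halt

  FirstHalt : ℕ → ℕ → Set
  FirstHalt e τ = halted e τ ≡ 1 × (∀ t → t < τ → halted e t ≡ 0)

  first-halt : ∀ e s → halted e s ≡ 1 → ∃ (FirstHalt e)
  first-halt e zero    h = 0 , h , λ _ ()
  first-halt e (suc s) h with 1 ≤? halted e s
  ... | yes p = first-halt e s (≤-antisym (halted≤1 e s) p)
  ... | no np = suc s , h , λ t p → ≱1⇒≡0 λ q → np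
    (≤-reflexive (sym (halts-stable (≤-antisym (halted≤1 e t) q) (s≤s⁻¹ p))))

  opaque
    unfolding time

    time-first : ∀ {e τ s} → FirstHalt e τ → τ ≤ s → time e s ≡ τ
    time-first {e} {τ} (h , m) p = trans (time-stable (≤-reflexive (sym h)) p)
      (trans (∑-cong τ (λ t q → cong (1 ∸_) (m t q))) (trans (∑-const τ 1) (*-identityʳ τ)))

  Dom⇒halted : ∀ {p} → Dom V p → ∃ λ t → halted (encode p) t ≡ 1
  Dom⇒halted (_ , r) with Runs⇒halts no-oracle-decides r
  ... | t , h , _ = t , h

  record Latest (n N : ℕ) : Set where
    field
      program : Str
      short   : length program ≤ n
      moment  : ℕ
      first   : FirstHalt (encode program) moment
      latest  : ∀ q → Dom V q → length q ≤ n → encode q < N → halted (encode q) moment ≡ 1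
  open Latest

  -- Induction over the codes below `N`, starting from the given `p`. If the string with code `N`
  -- halts after the current candidate, it becomes the new one; whether it halts at all is
  -- undecidable, hence the double negation.
  latest-exists : ∀ {n p} → Dom V p → length p ≤ n → ∀ N → ¬ ¬ Latest n N
  latest-exists {p = p} d l zero k with Dom⇒halted d
  ... | t , h with first-halt (encode p) t h
  ... | τ , f = k record { program = p ; short = l ; moment = τ ; first = f ; latest = λ _ _ _ () }
  latest-exists {n} d l (suc N) k = latest-exists d l N λ L →
    -- The refutation `k` is used twice: the old candidate survives unless the string with code `N`
    -- halts later, and in that case `later` hands the new candidate to `k`.
    k (extend L λ q e dq lq → let (t , h) = Dom⇒halted dq ; (τ , f) = first-halt (encode q) t h in later L q e dq lq τ f)
    where
    extend : (L : Latest n N) →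
      (∀ q → encode q ≡ N → Dom V q → length q ≤ n → halted (encode q) (moment L) ≡ 1) → Latest n (suc N)
    extend L h = record { program = program L ; short = short L ; moment = moment L ; first = first L
      ; latest = λ q dq lq p → case-≤ q dq lq (m≤n⇒m<n∨m≡n (s≤s⁻¹ p)) }
      where
      case-≤ : ∀ q → Dom V q → length q ≤ n → _ → halted (encode q) (moment L) ≡ 1
      case-≤ q dq lq (inj₁ p) = latest L q dq lq p
      case-≤ q dq lq (inj₂ e) = h q e dq lq
    later : (L : Latest n N) → ∀ q → encode q ≡ N → Dom V q → length q ≤ n →
      ∀ τ → FirstHalt (encode q) τ → halted (encode q) (moment L) ≡ 1
    later L q e dq lq τ f with ≤-total τ (moment L)
    ... | inj₁ p = halts-stable (proj₁ f) p
    ... | inj₂ p = ⊥-elim (k record { program = q ; short = lq ; moment = τ ; first = f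
          ; latest = λ q′ dq′ lq′ r → case-≤ q′ dq′ lq′ (m≤n⇒m<n∨m≡n (s≤s⁻¹ r)) })
      where
      case-≤ : ∀ q′ → Dom V q′ → length q′ ≤ n → _ → halted (encode q′) τ ≡ 1
      case-≤ q′ dq′ lq′ (inj₁ r)  = halts-stable (latest L q′ dq′ lq′ r) p
      case-≤ q′ dq′ lq′ (inj₂ e′) = subst (λ z → halted z τ ≡ 1) (trans e (sym e′)) (proj₁ f)

  -- All strings of length at most n have codes below 2^(n+1), so at the last halting time the
  -- approximation to the oracle is exact.
  χ-decides : ∀ {n} (L : Latest n (2 ^ suc n)) → Decides (χ n (moment L)) (Dom V ↾ n)
  χ-decides {n} L v = inside , outside
    where
    inside : InOracle (Dom V ↾ n) v → χ n (moment L) v ≡ 1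
    inside (s , refl , d , l) = cong₂ _*_ (⩽-intro (length≤⇒encode< l))
      (latest L s d l (<-trans ≤-refl (length≤⇒encode< l)))
    outside : ¬ InOracle (Dom V ↾ n) v → χ n (moment L) v ≡ 0
    outside h with 1 ≤? χ n (moment L) v
    ... | no p  = ≱1⇒≡0 p
    ... | yes p with encode-surjective v
    ... | s , refl = ⊥-elim (h (s , refl , halted⇒Dom {s} {moment L} (*-positiveʳ {[ 2 + v ⩽ 2 ^ suc n ]} p) ,
      encode<⇒length≤ (⩽⇒≤ (2 + v) (2 ^ suc n) (*-positiveˡ p))))

  -- Compressing prefixes of α

  module _ (α : BitSeq) where

    OftenComputed : Set
    OftenComputed = ∀ m → ∃ λ n → m ≤ n × ∃ λ j → j ≤ b × Runs (Dom V ↾ n) M n (encode (bits α (n ∸ j)))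

    cand-positive : ∀ {n j} → j ≤ b → Latest n (2 ^ suc n) →
      Runs (Dom V ↾ n) M n (encode (bits α (n ∸ j))) → ∃ λ s₀ → ∀ s → s₀ ≤ s → 1 ≤ cand s n α
    cand-positive {n} {j} j≤b L r with Runs⇒halts (χ-decides L) r | digits-surjective (program L)
    -- This waits both for V to halt on the program and for M to finish with the resulting oracle.
    ... | t , h , e | u , p , q = moment L + t , positive
      where
      positive : ∀ s → moment L + t ≤ s → 1 ≤ cand s n α
      positive s le = begin
        1  ≡⟨ sym (≐-refl (suc y)) ⟩
        [ suc y ≐ suc y ]  ≡⟨ cong [_≐ suc y ] (sym output) ⟩
        match s n α (length (program L)) u j
          ≤⟨ ∑-term (match s n α (length (program L)) u) (s≤s j≤b) ⟩
        ∑ (suc b) (match s n α (length (program L)) u)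
          ≤⟨ ∑-term (λ u → ∑ (suc b) (match s n α (length (program L)) u)) p ⟩
        ∑ (2 ^ length (program L)) (λ u → ∑ (suc b) (match s n α (length (program L)) u))
          ≤⟨ ∑-term (λ i → ∑ (2 ^ i) (λ u → ∑ (suc b) (match s n α i u))) (s≤s (short L)) ⟩
        cand s n α  ∎
        where
        open ≤-Reasoning
        y : ℕ
        y = encode (bits α (n ∸ j))
        τ≤s : moment L ≤ s
        τ≤s = ≤-trans (m≤m+n _ t) le
        t≤s : t ≤ s
        t≤s = ≤-trans (m≤n+m t _) le
        time≡ : time (encode (program L)) s ≡ moment L
        time≡ = time-first (first L) τ≤s
        output : out s n (encode (bits (digits u) (length (program L)))) ≡ suc y
        output = trans (cong (λ z → out s n (encode z)) q) (out-intro
          (halts-stable (proj₁ (first L)) τ≤s)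
          (trans (cong (λ z → halts M (χ n z) n s) time≡) (halts-stable h t≤s))
          (trans (cong (λ z → result M (χ n z) n s) time≡) (trans (result-stable h t≤s) e)))

    -- A level n beyond the current stage s is not yet counted and adds at least 1. Asking also for
    -- n ≥ |p| ensures that some program of length at most n halts.
    count-unbounded : ∀ {p} → Dom V p →
      OftenComputed →
      ∀ T → ¬ ¬ ∃ λ s → T ≤ count s α
    count-unbounded d good zero    k = k (0 , z≤n)
    count-unbounded {p} d good (suc T) k =
      count-unbounded d good T λ { (s , g) → enlarge s g (good (suc s + length p)) }
      where
      enlarge : ∀ s → T ≤ count s α →
        (∃ λ n → suc s + length p ≤ n × ∃ λ j → j ≤ b × Runs (Dom V ↾ n) M n (encode (bits α (n ∸ j)))) → ⊥
      enlarge s g (n , m≤n , j , j≤b , r) =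
        latest-exists d (≤-trans (m≤n+m (length p) (suc s)) m≤n) (2 ^ suc n) λ L →
          let (s₀ , h) = cand-positive j≤b L r
              s′ = s₀ + n
              s<n = ≤-trans (m≤m+n (suc s) (length p)) m≤n
              s<s′ = ≤-trans s<n (m≤n+m n s₀)
          in k (s′ , (begin
            suc T                                ≤⟨ s≤s g ⟩
            suc (count s α)                      ≡⟨ +-comm 1 (count s α) ⟩
            count s α + 1                        ≤⟨ +-mono-≤ (∑-mono (suc s) (λ n _ → cand-mono n α (<⇒≤ s<s′))) (h s′ (m≤m+n s₀ n)) ⟩
            ∑ (suc s) (λ n → cand s′ n α) + cand s′ n α ≤⟨ +-monoˡ-≤ (cand s′ n α) (∑-extend (λ n → cand s′ n α) s<n) ⟩
            ∑ (suc n) (λ n → cand s′ n α)        ≤⟨ ∑-extend (λ n → cand s′ n α) (s≤s (m≤n+m n s₀)) ⟩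
            count s′ α                           ∎))
        where open ≤-Reasoning

    record Compression (k : ℕ) : Set where
      constructor compression
      field
        rest      : ℕ
        word      : Str
        length≡   : length word ≡ suc (k + rest)
        describes : machine ⟦ word ⟧≡ bits α (rest + (k + k))

    compressible : ∀ k {s} → threshold k ≤ count s α →
      Compression k
    compressible k {s} g with ∑-positive (suc s) {λ i → new k i α}
      (≤-reflexive (sym (trans (big-telescopes k s α) (⩽-intro g))))
    ... | i , _ , p with digits-of α i
    ... | w , w< , agree = compression ℓ (codeword k ℓ w) (trans (length-header k _) (cong (λ z → suc (k + z)) (length-msb ℓ _)))
      (subst (machine ⟦ codeword k ℓ w ⟧≡_) (trans (cong (bits (digits w)) i≡) (trans (bits-cong i agree) (cong (bits α) (sym i≡))))
        (machine-sound (decoder-complete {k} {ℓ} v′)))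
      where
      ℓ : ℕ
      ℓ = i ∸ (k + k)
      v : Valid k i w
      v = valid w< (≤-trans p (≤-reflexive (sym (new-local k i agree))))
      2k≤i : k + k ≤ i
      -- A new word makes `total k i` positive, so `total-bound` gives 4^k ≤ 2^i; the subtraction
      -- defining ℓ is therefore exact.
      2k≤i = ≮⇒≥ λ i<2k → <⇒≱ (^-monoʳ-< 2 ≤-refl i<2k)
        (≤-trans (m≤m*n (2 ^ (k + k)) (total k i) {{>-nonZero (≤-<-trans z≤n (index-< v))}}) (total-bound k i))
      i≡ : ℓ + (k + k) ≡ i
      i≡ = m∸n+n≡m 2k≤i
      v′ : Valid k (stage k ℓ) w
      v′ = subst (λ z → Valid k z w) (sym i≡) v

    compressions : ∀ {p} → Dom V p →
      OftenComputed →
      ∀ k → ¬ ¬ Compression k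
    compressions d good k h = count-unbounded d good (threshold k) λ where (s , g) → h (compressible k {s} g)

-- Optimality and the contradiction

optimal-inhabited : ∀ {V} → IsOptimal V → ∃ (Dom V)
optimal-inhabited (_ , optimal) with optimal only-empty only-empty-computer
  where
  only-empty : Program
  -- Input 0, the code of the empty string, jumps out of the program at once; any other input is
  -- trapped by the `inc` that returns to itself.
  only-empty = dec 0 1 2 ∷ inc 1 1 ∷ []
  loops : ∀ {S h} → Star (Step ∅ only-empty) (1 , S) h → proj₁ h ≡ 1
  loops ε = refl
  loops (s-inc refl ◅ st) = loops st
  loops (s-decZ () _ ◅ _)
  loops (s-decS () _ ◅ _)
  loops (s-askY () _ ◅ _)
  loops (s-askN () _ ◅ _)
  halts-on : ∀ {p} → Dom only-empty p → encode p ≡ 0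
  halts-on (_ , _ , _ , ε , () , _)
  halts-on (_ , _ , _ , s-inc () ◅ _ , _)
  halts-on (_ , _ , _ , s-decZ refl e ◅ _ , _) = e
  halts-on (_ , _ , _ , s-decS refl e ◅ st , h , _) with trans (sym h) (cong (fetch only-empty) (loops st))
  ... | ()
  halts-on (_ , _ , _ , s-askY () _ ◅ _ , _)
  halts-on (_ , _ , _ , s-askN () _ ◅ _ , _)
  only-empty-computer : IsComputer only-empty
  only-empty-computer p q d e _ = encode-injective (trans (halts-on {p} d) (sym (halts-on {q} e)))
... | _ , h with h [] [] (2 , initRegs 0 , s-decZ refl refl ◅ ε , refl , refl)
... | q , r , _ = q , [] , r

theorem4p6 : (U : Program) → IsOptimal U →
    (α : BitSeq) → InfinitelyManyZeros α → WeaklyChaitinRandom U α →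
    (V : Program) → IsOptimal V →
    (f : ℕ → ℕ) → TotalRecursive⁺ f →
    (∃ λ M → ∀ m → ∃ λ n → m ≤ n × 1 ≤ n ×
    Runs (Dom V ↾ n) M n (encode (bits α (n ∸ f n)))) →
    ¬ BoundedAbove⁺ f
theorem4p6 U (_ , optimal) α _ (c , random) V V-optimal f _ (M , good) (b , bounded) =
  compressions α (proj₂ (optimal-inhabited V-optimal)) good′ k contradict
  where
  open Construction V M (proj₁ V-optimal) b
  simulation : ∃ λ d → ∀ p s → machine ⟦ p ⟧≡ s → ∃ λ q → U ⟦ q ⟧≡ s × length q ≤ length p + d
  simulation = optimal machine machine-computer
  d k : ℕ
  d = proj₁ simulation
  -- The saving k - 1 must exceed c, allowed by randomness, plus d, the cost of simulation by U.
  k = 2 + (c + d)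
  good′ : OftenComputed α
  good′ m = let (n , m≤n , 1≤n , r) = good m in n , m≤n , f n , bounded n 1≤n , r
  too-short : ∀ ℓ (q q′ : Str) → length q ≡ suc (k + ℓ) → length q′ ≤ length q + d →
    ¬ U ⟦ q′ ⟧≡ bits α (ℓ + (k + k))
  too-short ℓ q q′ len short run = <⇒≱ gap (≤-trans (m≤n+m∸n (ℓ + (k + k)) c)
    (+-monoʳ-≤ c (random (ℓ + (k + k)) (≤-trans (s≤s z≤n) (m≤n+m (k + k) ℓ)) q′ run)))
    where
    open ≤-Reasoning
    gap : c + length q′ < ℓ + (k + k)
    gap = begin-strict
      c + length q′                 ≤⟨ +-monoʳ-≤ c short ⟩
      c + (length q + d)            ≡⟨ cong (λ z → c + (z + d)) len ⟩
      c + (suc (k + ℓ) + d)         <⟨ ≤-refl ⟩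
      suc (c + (suc (k + ℓ) + d))
        ≡⟨ solve 4 (λ c d k ℓ → con 1 :+ (c :+ (con 1 :+ (k :+ ℓ) :+ d)) := ℓ :+ (k :+ (con 2 :+ (c :+ d)))) refl c d k ℓ ⟩
      ℓ + (k + k)                   ∎
  contradict : ¬ Compression α k
  contradict (compression ℓ q len run) =
    let (q′ , run′ , short) = proj₂ simulation q (bits α (ℓ + (k + k))) run
    in too-short ℓ q q′ len short run′
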